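{- The public coin certificate game complexity of the approximate index function $\mathsf{ApInd}_k$, which has $n=k+2^k$ input positions, satisfies $$\mathsf{CG}^{\mathrm{pub}}(\mathsf{ApInd}_k)=O(\log k)\qquad(k\to\infty).$$
   Context: Approximate index function: $\mathsf{ApInd}_k:\{0,1\}^k\times\{0,1,2\}^{2^k}\to\{0,1,*\}$. An input is $(a,x)$ with address $a\in\{0,1\}^k$ and table $x=(x_b)_{b\in\{0,1\}^k}$, $x_b\in\{0,1,2\}$. Writing $|b-a|$ for the Hamming distance of $a,b$: $\mathsf{ApInd}_k(a,x)=x_a$ if $x_b=x_a\in\{0,1\}$ for all $b$ with $|b-a|\le\frac k2-\sqrt{k\log k}$ and $x_b=2$ for all other $b$; otherwise $\mathsf{ApInd}_k(a,x)=*$ (undefined). (Entries from $\{0,1,2\}$ may equivalently be encoded in bits, which changes bounds only by a constant factor.) Public coin certificate game complexity of a partial function $f$ on strings with $n$ positions: one player receives $u\in f^{ -1}(0)$, the other $v\in f^{ -1}(1)$; without communication they must output a common position $i$ with $u_i\ne v_i$. A deterministic strategy is a pair $(A,B)$ of functions from $f^{ -1}(0)$, respectively $f^{ -1}(1)$, to the set of $n$ positions (here the $k$ address positions and the $2^k$ table positions); it is correct on $(u,v)$ if $A(u)=B(v)=i$ with $u_i\ne v_i$. Then $\mathsf{CG}^{\mathrm{pub}}(f)=\min_p\max_{u\in f^{ -1}(0),v\in f^{ -1}(1)}\Big(\sum_{(A,B)\text{ correct on }(u,v)}p_{A,B}\Big)^{ -1}$, with $p$ ranging over probability distributions on pairs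 $(A,B)$ of deterministic strategies, and $1/0=+\infty$. -}

module Defs where

open import Data.Bool using (Bool; true; false; T?; _xor_; if_then_else_)
import Data.Bool.Properties as Bool
open import Data.Fin using (Fin; zero; suc)
import Data.Fin.Properties as Fin
open import Data.Fin.Subset.Properties using (anySubset?)
open import Data.Integer using (+_)
open import Data.List using (List; map; filter; foldr)
open import Data.List.Relation.Unary.All using (All)
open import Data.Maybe using (Maybe; just; nothing)
open import Data.Nat as ℕ using (ℕ; _≥_)
open import Data.Product using (Σ-syntax; ∃-syntax; _×_; _,_; proj₁; proj₂)
open import Data.Rational as ℚ using (ℚ; 0ℚ; 1ℚ; 1/_; _/_)
import Data.Rational.Properties as ℚ
open import Data.Sum using (_⊎_; inj₁; inj₂)
import Data.Sum.Properties as Sum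
open import Data.Vec as Vec using (Vec; lookup; zipWith)
import Data.Vec.Properties as Vec
open import Function using (_∘_)
open import Relation.Binary.Definitions using (DecidableEquality)
open import Relation.Binary.PropositionalEquality using (_≡_; _≢_)
open import Relation.Nullary using (¬_; Dec; yes; no; does)
open import Relation.Nullary.Decidable
  using (_×-dec_; _→-dec_; ¬?; map′; decidable-stable)
open import Relation.Nullary.Construct.Add.Supremum using (_⁺; [_]; ⊤⁺)
open import Relation.Binary.Construct.Add.Supremum.NonStrict ℚ._≤_ using (_≤⁺_)
open import Relation.Unary using (Decidable)

-- Finitely supported distributions.  The list may repeat an outcome; its
-- probability is then the sum of the corresponding weights.

sumℚ : List ℚ → ℚ
sumℚ = foldr ℚ._+_ 0ℚ

record Distribution (A : Set) : Set where
  field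
    weighted : List (ℚ × A)
    nonNeg   : All (λ wa → 0ℚ ℚ.≤ proj₁ wa) weighted
    total    : sumℚ (map proj₁ weighted) ≡ 1ℚ

prob : {A : Set} → Distribution A → {P : A → Set} → Decidable P → ℚ
prob p P? = sumℚ (map proj₁ (filter (P? ∘ proj₂) (Distribution.weighted p)))

-- ℚ ⁺ is ℚ with a top element ⊤⁺, playing the role of +∞.

reciprocal : ℚ → ℚ ⁺
reciprocal q with q ℚ.≟ 0ℚ
... | yes _  = ⊤⁺
... | no q≢0 = [ (1/ q) {{ℚ.≢-nonZero q≢0}} ]

-- Partial functions on strings; the alphabet may depend on the position, and
-- nothing stands for "undefined".

record PartialFunction : Set₁ where
  field
    Input    : Set
    Position : Set
    Symbol   : Position → Set
    _at_     : Input → (i : Position) → Symbol i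
    _≟ᴾ_     : DecidableEquality Position
    _≟ˢ_     : ∀ {i} → DecidableEquality (Symbol i)
    value    : Input → Maybe Bool

module CertificateGame (f : PartialFunction) where
  open PartialFunction f

  Preimage : Bool → Set
  Preimage v = Σ[ u ∈ Input ] value u ≡ just v

  StrategyPair : Set
  StrategyPair = (Preimage false → Position) × (Preimage true → Position)

  Correct : Preimage false → Preimage true → StrategyPair → Set
  Correct u v (A , B) = A u ≡ B v × proj₁ u at A u ≢ proj₁ v at A u

  correct? : ∀ u v → Decidable (Correct u v)
  correct? u v (A , B) =
    (A u ≟ᴾ B v) ×-dec ¬? ((proj₁ u at A u) ≟ˢ (proj₁ v at A u))

  cost : Distribution StrategyPair → Preimage false → Preimage true → ℚ ⁺
  cost p u v = reciprocal (prob p (correct? u v))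

-- CGpub f ≤ c says  min_p max_{u,v} cost p u v ≤ c.  For finitely many
-- inputs the minimum is the value of a linear program with rational data, so
-- it is attained, and attained at rational weights.

CGpub_≤_ : PartialFunction → ℚ → Set
CGpub f ≤ c = ∃[ p ] ∀ u v → cost p u v ≤⁺ [ c ]
  where open CertificateGame f

-- If g k ≥ 1 for large k, allowing only natural constants C is no restriction.

CGpub_≤O_ : (ℕ → PartialFunction) → (ℕ → ℕ) → Set
CGpub F ≤O g =
  ∃[ C ] ∃[ k₀ ] ∀ k → k ≥ k₀ → CGpub (F k) ≤ (+ (C ℕ.* g k) / 1)

Address : ℕ → Set
Address k = Vec Bool k

Table : ℕ → Set
Table k = Address k → Fin 3

ApInput : ℕ → Set
ApInput k = Address k × Table k

ApPosition : ℕ → Set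
ApPosition k = Fin k ⊎ Address k

ApSymbol : ∀ {k} → ApPosition k → Set
ApSymbol (inj₁ _) = Bool
ApSymbol (inj₂ _) = Fin 3

_≟ᵃ_ : ∀ {k} → DecidableEquality (Address k)
_≟ᵃ_ = Vec.≡-dec Bool._≟_

hamming : ∀ {k} → Address k → Address k → ℕ
hamming a b = Vec.count T? (zipWith _xor_ a b)

-- For k ≥ 1 and d = hamming a b, this is  d ≤ k/2 - √(k log₂ k)  exactly:
-- the latter holds iff  2d ≤ k  and  4k log₂ k ≤ (k - 2d)²,  and the second
-- inequality is equivalent to  k^(4k) ≤ 2^((k - 2d)²).

Near : ∀ {k} → Address k → Address k → Set
Near {k} a b =
    2 ℕ.* hamming a b ℕ.≤ k
  × k ℕ.^ (4 ℕ.* k) ℕ.≤ 2 ℕ.^ ((k ℕ.∸ 2 ℕ.* hamming a b) ℕ.^ 2)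

near? : ∀ {k} (a b : Address k) → Dec (Near a b)
near? a b = (_ ℕ.≤? _) ×-dec (_ ℕ.≤? _)

bit : Bool → Fin 3
bit false = zero
bit true  = suc zero

two : Fin 3
two = suc (suc zero)

Encodes : ∀ {k} → Bool → ApInput k → Set
Encodes v (a , x) =
    x a ≡ bit v
  × (∀ b → (Near a b → x b ≡ bit v) × (¬ Near a b → x b ≡ two))

allAddresses? : ∀ {k} {P : Address k → Set} → Decidable P → Dec (∀ b → P b)
allAddresses? P? =
  map′ (λ ¬∃ b → decidable-stable (P? b) (λ ¬p → ¬∃ (b , ¬p)))
       (λ h (b , ¬p) → ¬p (h b))
       (¬? (anySubset? (¬? ∘ P?)))

encodes? : ∀ {k} v (u : ApInput k) → Dec (Encodes v u)
encodes? v (a , x) =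
  (x a Fin.≟ bit v) ×-dec allAddresses? λ b →
    (near? a b →-dec (x b Fin.≟ bit v)) ×-dec
    (¬? (near? a b) →-dec (x b Fin.≟ two))

apInd : ∀ {k} → ApInput k → Maybe Bool
apInd u =
  if does (encodes? false u) then just false else
  if does (encodes? true u) then just true else nothing

ApInd : ℕ → PartialFunction
ApInd k = record
  { Input    = ApInput k
  ; Position = ApPosition k
  ; Symbol   = ApSymbol
  ; _at_     = λ { (a , x) (inj₁ i) → lookup a i ; (a , x) (inj₂ b) → x b }
  ; _≟ᴾ_     = Sum.≡-dec Fin._≟_ _≟ᵃ_
  ; _≟ˢ_     = λ { {inj₁ _} → Bool._≟_ ; {inj₂ _} → Fin._≟_ }
  ; value    = apInd
  }

-- Let d be the Hamming distance of the two addresses a and b.  If d is at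
-- least of order k/log k, a common random address bit already separates them
-- with probability d/k.  Otherwise each player samples a table position from
-- the product measure centred at the own address, whose coordinates agree with
-- it with probability 1/2 + δ, δ of order √(log k/k).  The measures of a and b
-- have fidelity (1 - 4δ²)^(d/2), which is near 1, so they overlap in a constant
-- fraction of their mass and correlated sampling makes the two samples equal
-- with constant probability.  By Chebyshev's inequality the sample lies
-- outside the ball around a, where the tables could coincide, only with small
-- probability.

module Submission where

open import Defs
open import Data.Nat.Logarithm using (⌊log₂_⌋; ⌊log₂⌋-mono-≤; ⌊log₂[2^n]⌋≡n)
open import Data.Bool using (Bool; true; false; if_then_else_; _xor_)
import Data.Bool.Properties as Bool
open import Data.Fin using (Fin; suc)
import Data.Integer as ℤ
import Data.Integer.Properties as ℤ
open import Data.List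
  using (List; []; _∷_; map; length; _++_; cartesianProductWith; cartesianProduct; downFrom; allFin; filter; tabulate)
open import Data.List.Properties
  using (map-++; map-∘; map-tabulate; length-map; length-++; length-tabulate; length-downFrom)
open import Data.List.Relation.Unary.All as All using (All)
open import Data.Maybe using (just; nothing)
open import Data.Nat
open import Data.Nat.DivMod using (m/n*n≤m; m≡m%n+[m/n]*n; m%n<n)
open import Data.Nat.ListAction using (sum)
open import Data.Nat.ListAction.Properties using (sum-++)
open import Data.Nat.Properties
open import Data.Nat.Tactic.RingSolver using (solve-∀)
open import Data.Product using (_×_; _,_; proj₁; proj₂; ∃-syntax)
open import Data.Rational as ℚ using (ℚ; 0ℚ; 1ℚ)
import Data.Rational.Properties as ℚ
open import Data.Rational.Unnormalised as ℚᵘ using (mkℚᵘ; *≡*; *≤*)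
import Data.Rational.Unnormalised.Properties as ℚᵘ
open import Data.Sum using (inj₁; inj₂)
open import Data.Vec using ([]; _∷_; lookup)
open import Function using (_∘_; id)
open import Relation.Binary.Construct.Add.Supremum.NonStrict ℚ._≤_ using (_≤⁺_; [_])
open import Relation.Binary.Definitions using (DecidableEquality)
open import Relation.Binary.PropositionalEquality
  using (_≡_; _≢_; refl; sym; trans; cong; cong₂; subst; module ≡-Reasoning)
open import Relation.Nullary using (¬_; Dec; yes; no; does; contradiction)
open import Relation.Nullary.Construct.Add.Supremum using ([_])
open import Relation.Nullary.Decidable using (_×-dec_; ¬?)
open import Relation.Unary using (Decidable)

-- Distributions are finite with rational weights, but the argument involves square roots in the
-- fidelity and an unbounded run of rejection sampling. To avoid the roots, the agreement
-- probability is (m+1)²/w with w = m² + (m+1)². The amplitudes are then integers, 2δ = (2m+1)/w,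
-- and the root of 1 - 4δ² is exactly (w-1)/w, so that addresses at distance d have fidelity (1 -
-- 1/w)^d ≥ 1 - d/w. The run is cut off after finitely many rounds, and strategies are entries of a
-- list with repetitions. All probabilities are thus counts in ℕ, and rationals enter only at the
-- end.
--
-- The one parameter w carries the trade-off. With L = ⌊log₂ k⌋, it must be at most of order k/L,
-- for a bias of order 1/√w to carry the sample into the ball. It should not be of smaller order,
-- because addresses at distance above w/4 rely on the address bits, which succeed with probability
-- of order w/k. The largest admissible w gives order 1/L there and a constant elsewhere.

private variable
  A B C P Q : Set

≤-byWitness : ∀ {m n} e → m + e ≡ n → m ≤ n
≤-byWitness {m} e eq = ≤-trans (m≤m+n m e) (≤-reflexive eq)

2ab≤a²+b² : ∀ a b → 2 * a * b ≤ a * a + b * b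
2ab≤a²+b² a b with ≤-total a b
... | inj₁ a≤b with e , refl ← m≤n⇒∃[o]m+o≡n a≤b = ≤-byWitness (e * e) (identity a e)
  where
  identity : ∀ a e → 2 * a * (a + e) + e * e ≡ a * a + (a + e) * (a + e)
  identity = solve-∀
... | inj₂ b≤a with e , refl ← m≤n⇒∃[o]m+o≡n b≤a = ≤-byWitness (e * e) (identity b e)
  where
  identity : ∀ b e → 2 * (b + e) * b + e * e ≡ (b + e) * (b + e) + b * b
  identity = solve-∀

-- Finite sums and counting

∑ : List A → (A → ℕ) → ℕ
∑ xs f = sum (map f xs)

∑-mono : ∀ (xs : List A) {f g} → (∀ x → f x ≤ g x) → ∑ xs f ≤ ∑ xs g
∑-mono []       f≤g = z≤n
∑-mono (x ∷ xs) f≤g = +-mono-≤ (f≤g x) (∑-mono xs f≤g)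

∑-cong : ∀ (xs : List A) {f g} → (∀ x → f x ≡ g x) → ∑ xs f ≡ ∑ xs g
∑-cong []       f≡g = refl
∑-cong (x ∷ xs) f≡g = cong₂ _+_ (f≡g x) (∑-cong xs f≡g)

∑-+ : ∀ (xs : List A) f g → ∑ xs (λ x → f x + g x) ≡ ∑ xs f + ∑ xs g
∑-+ []       f g = refl
∑-+ (x ∷ xs) f g = trans (cong (f x + g x +_) (∑-+ xs f g)) (interchange (f x) (g x) (∑ xs f) (∑ xs g))
  where
  interchange : ∀ a b c d → a + b + (c + d) ≡ a + c + (b + d)
  interchange = solve-∀

∑-*ˡ : ∀ (xs : List A) c f → ∑ xs (λ x → c * f x) ≡ c * ∑ xs f
∑-*ˡ []       c f = sym (*-zeroʳ c)
∑-*ˡ (x ∷ xs) c f = trans (cong (c * f x +_) (∑-*ˡ xs c f)) (sym (*-distribˡ-+ c (f x) (∑ xs f)))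

∑-*ʳ : ∀ (xs : List A) f c → ∑ xs (λ x → f x * c) ≡ ∑ xs f * c
∑-*ʳ xs f c = begin
  ∑ xs (λ x → f x * c) ≡⟨ ∑-cong xs (λ x → *-comm (f x) c) ⟩
  ∑ xs (λ x → c * f x) ≡⟨ ∑-*ˡ xs c f ⟩
  c * ∑ xs f           ≡⟨ *-comm c _ ⟩
  ∑ xs f * c           ∎
  where open ≡-Reasoning

∑-const : ∀ (xs : List A) c → ∑ xs (λ _ → c) ≡ length xs * c
∑-const []       c = refl
∑-const (x ∷ xs) c = cong (c +_) (∑-const xs c)

∑-++ : ∀ (xs ys : List A) f → ∑ (xs ++ ys) f ≡ ∑ xs f + ∑ ys f
∑-++ xs ys f = trans (cong sum (map-++ f xs ys)) (sum-++ (map f xs) (map f ys))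

∑-map : ∀ (h : A → B) xs f → ∑ (map h xs) f ≡ ∑ xs (f ∘ h)
∑-map h xs f = cong sum (sym (map-∘ xs))

∑-cartesianProductWith : ∀ (h : A → B → C) xs ys f →
  ∑ (cartesianProductWith h xs ys) f ≡ ∑ xs (λ x → ∑ ys (λ y → f (h x y)))
∑-cartesianProductWith h []       ys f = refl
∑-cartesianProductWith h (x ∷ xs) ys f = begin
  ∑ (map (h x) ys ++ cartesianProductWith h xs ys) f
    ≡⟨ ∑-++ (map (h x) ys) _ f ⟩
  ∑ (map (h x) ys) f + ∑ (cartesianProductWith h xs ys) f
    ≡⟨ cong₂ _+_ (∑-map (h x) ys f) (∑-cartesianProductWith h xs ys f) ⟩
  ∑ ys (f ∘ h x) + ∑ xs (λ x′ → ∑ ys (λ y → f (h x′ y))) ∎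
  where open ≡-Reasoning

length≡∑1 : (xs : List A) → length xs ≡ ∑ xs (λ _ → 1)
length≡∑1 xs = sym (trans (∑-const xs 1) (*-identityʳ _))

length-cartesianProductWith : ∀ (h : A → B → C) xs ys →
  length (cartesianProductWith h xs ys) ≡ length xs * length ys
length-cartesianProductWith h xs ys = begin
  length (cartesianProductWith h xs ys)       ≡⟨ length≡∑1 (cartesianProductWith h xs ys) ⟩
  ∑ (cartesianProductWith h xs ys) (λ _ → 1)  ≡⟨ ∑-cartesianProductWith h xs ys (λ _ → 1) ⟩
  ∑ xs (λ _ → ∑ ys (λ _ → 1))                 ≡⟨ ∑-cong xs (λ _ → sym (length≡∑1 ys)) ⟩
  ∑ xs (λ _ → length ys)                      ≡⟨ ∑-const xs _ ⟩
  length xs * length ys                       ∎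
  where open ≡-Reasoning

if-yes : (P? : Dec P) {x y : A} → P → (if does P? then x else y) ≡ x
if-yes (yes _) p = refl
if-yes (no ¬p) p = contradiction p ¬p

if-no : (P? : Dec P) {x y : A} → ¬ P → (if does P? then x else y) ≡ y
if-no (yes p) ¬p = contradiction p ¬p
if-no (no _)  ¬p = refl

𝟙 : Dec P → ℕ
𝟙 P? = if does P? then 1 else 0

𝟙-mono : (P? : Dec P) (Q? : Dec Q) → (P → Q) → 𝟙 P? ≤ 𝟙 Q?
𝟙-mono (yes p) (yes q) P⇒Q = ≤-refl
𝟙-mono (yes p) (no ¬q) P⇒Q = contradiction (P⇒Q p) ¬q
𝟙-mono (no ¬p) Q?      P⇒Q = z≤n

𝟙-yes : (P? : Dec P) → P → 𝟙 P? ≡ 1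
𝟙-yes P? = if-yes P?

𝟙-no : (P? : Dec P) → ¬ P → 𝟙 P? ≡ 0
𝟙-no P? = if-no P?

# : {P : A → Set} → Decidable P → List A → ℕ
# P? xs = ∑ xs (λ x → 𝟙 (P? x))

#-mono : ∀ {P Q : A → Set} (P? : Decidable P) (Q? : Decidable Q) xs → (∀ x → P x → Q x) → # P? xs ≤ # Q? xs
#-mono P? Q? xs P⇒Q = ∑-mono xs (λ x → 𝟙-mono (P? x) (Q? x) (P⇒Q x))

#-all : ∀ {P : A → Set} (P? : Decidable P) xs → (∀ x → P x) → # P? xs ≡ length xs
#-all P? xs all = trans (∑-cong xs (λ x → 𝟙-yes (P? x) (all x))) (sym (length≡∑1 xs))

length-filter≡# : ∀ {P : A → Set} (P? : Decidable P) xs → length (filter P? xs) ≡ # P? xs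
length-filter≡# P? [] = refl
length-filter≡# P? (x ∷ xs) with P? x
... | yes _ = cong suc (length-filter≡# P? xs)
... | no  _ = length-filter≡# P? xs

#-<-downFrom : ∀ n k → # (_<? n) (downFrom k) ≡ n ⊓ k
#-<-downFrom n zero    = sym (⊓-zeroʳ n)
#-<-downFrom n (suc k) = step (k <? n)
  where
  open ≡-Reasoning
  step : Dec (k < n) → 𝟙 (k <? n) + # (_<? n) (downFrom k) ≡ n ⊓ suc k
  step (yes k<n) = begin
    𝟙 (k <? n) + # (_<? n) (downFrom k) ≡⟨ cong₂ _+_ (𝟙-yes (k <? n) k<n) (#-<-downFrom n k) ⟩
    suc (n ⊓ k)                         ≡⟨ cong suc (m≥n⇒m⊓n≡n (<⇒≤ k<n)) ⟩
    suc k                               ≡⟨ m≥n⇒m⊓n≡n k<n ⟨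
    n ⊓ suc k                           ∎
  step (no k≮n) = begin
    𝟙 (k <? n) + # (_<? n) (downFrom k) ≡⟨ cong₂ _+_ (𝟙-no (k <? n) k≮n) (#-<-downFrom n k) ⟩
    n ⊓ k                               ≡⟨ m≤n⇒m⊓n≡m (≮⇒≥ k≮n) ⟩
    n                                   ≡⟨ m≤n⇒m⊓n≡m (m≤n⇒m≤1+n (≮⇒≥ k≮n)) ⟨
    n ⊓ suc k                           ∎

-- Correlated sampling

-- Each round proposes a uniformly random pair (y , l) with l < bound, and a
-- player holding a answers y if l < weight a y, so conditionally on accepting
-- y is chosen with probability proportional to weight a y.
module CorrelatedSampling
  (weight : A → B → ℕ) (outcomes : List B) (bound : ℕ) (default : A → B)
  where

  proposals : List (B × ℕ)
  proposals = cartesianProduct outcomes (downFrom bound)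

  override : B × ℕ → (A → B) → A → B
  override (y , l) g a = if does (l <? weight a y) then y else g a

  -- One entry for each sequence of `t` proposals, so that a uniform entry is a run of `t`
  -- independent rounds. The earliest accepted proposal wins, since `override` consults the later
  -- rounds only on rejection.
  rounds : ℕ → List (A → B)
  rounds zero    = default ∷ []
  rounds (suc t) = cartesianProductWith override proposals (rounds t)

  -- With as many rounds as proposals (and one more, to avoid the case of none)
  -- the risk of never accepting costs only a constant factor.
  enoughRounds : ℕ
  enoughRounds = suc (length proposals)

  length-rounds : ∀ t → length (rounds t) ≡ length proposals ^ t
  length-rounds zero    = refl
  length-rounds (suc t) = trans (length-cartesianProductWith override proposals (rounds t))
                                (cong (length proposals *_) (length-rounds t))

  override-accept : ∀ {y l a} g → l < weight a y → override (y , l) g a ≡ y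
  override-accept {y} {l} {a} g = if-yes (l <? weight a y)

  override-reject : ∀ {y l a} g → ¬ l < weight a y → override (y , l) g a ≡ g a
  override-reject {y} {l} {a} g = if-no (l <? weight a y)

  module _ {Q : B → Set} (Q? : Decidable Q) (_≟ᴮ_ : DecidableEquality B) (a b : A) where

    Success : (A → B) → Set
    Success g = g a ≡ g b × Q (g a)

    success? : Decidable Success
    success? g = (g a ≟ᴮ g b) ×-dec Q? (g a)

    -- A hit settles the game favourably and a miss leaves it open. All other proposals, such as
    -- those accepted by one player only, are given up as lost.
    Hit Miss : B × ℕ → Set
    Hit  (y , l) = Q y × l < weight a y ⊓ weight b y
    Miss (y , l) = ¬ l < weight a y × ¬ l < weight b y

    hit? : Decidable Hit
    hit? (y , l) = Q? y ×-dec (l <? weight a y ⊓ weight b y)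

    miss? : Decidable Miss
    miss? (y , l) = ¬? (l <? weight a y) ×-dec ¬? (l <? weight b y)

    -- Bounds for the number of hits from below and of proposals other than misses from above;
    -- `shared` / `total` is the success probability to aim for.
    shared total : ℕ
    shared = ∑ outcomes (λ y → 𝟙 (Q? y) * (weight a y ⊓ weight b y))
    total   = ∑ outcomes (λ y → weight a y + weight b y)

    module _ (weight≤bound : ∀ y → weight a y ≤ bound) where
      open ≤-Reasoning

      -- The levels below both weights are accepted by both players, and none of them is lost
      -- because `bound` does not cut off `weight a y`.
      shared≤#hit : shared ≤ # hit? proposals
      shared≤#hit = begin
        ∑ outcomes (λ y → 𝟙 (Q? y) * (weight a y ⊓ weight b y))
          ≤⟨ ∑-mono outcomes pointwise ⟩
        ∑ outcomes (λ y → # (λ l → hit? (y , l)) (downFrom bound))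
          ≡⟨ ∑-cartesianProductWith _,_ outcomes (downFrom bound) _ ⟨
        # hit? proposals ∎
        where
        pointwise : ∀ y → 𝟙 (Q? y) * (weight a y ⊓ weight b y) ≤ # (λ l → hit? (y , l)) (downFrom bound)
        pointwise y with Q? y
        ... | no  _ = z≤n
        ... | yes q = begin
          1 * n                                    ≡⟨ *-identityˡ n ⟩
          n                                        ≡⟨ m≤n⇒m⊓n≡m (≤-trans (m⊓n≤m _ _) (weight≤bound y)) ⟨
          n ⊓ bound                                ≡⟨ #-<-downFrom n bound ⟨
          # (_<? n) (downFrom bound)               ∎
          where n = weight a y ⊓ weight b y

      -- Union bound: a proposal that is no miss is accepted by `a` or by `b`, and each of them
      -- accepts y at no more levels than its weight.
      #proposals≤#miss+total : length proposals ≤ # miss? proposals + total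
      #proposals≤#miss+total = begin
        length proposals
          ≡⟨ length-cartesianProductWith _,_ outcomes (downFrom bound) ⟩
        length outcomes * length (downFrom bound)
          ≡⟨ ∑-const outcomes _ ⟨
        ∑ outcomes (λ _ → length (downFrom bound))
          ≤⟨ ∑-mono outcomes pointwise ⟩
        ∑ outcomes (λ y → # (λ l → miss? (y , l)) (downFrom bound) + (weight a y + weight b y))
          ≡⟨ ∑-+ outcomes _ _ ⟩
        ∑ outcomes (λ y → # (λ l → miss? (y , l)) (downFrom bound)) + total
          ≡⟨ cong (_+ total) (∑-cartesianProductWith _,_ outcomes (downFrom bound) _) ⟨
        # miss? proposals + total ∎
        where
        cases : ∀ {P Q : Set} (P? : Dec P) (Q? : Dec Q) → 1 ≤ 𝟙 (¬? P? ×-dec ¬? Q?) + (𝟙 P? + 𝟙 Q?)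
        cases (yes _) Q?      = s≤s z≤n
        cases (no _)  (yes _) = s≤s z≤n
        cases (no _)  (no _)  = s≤s z≤n
        pointwise : ∀ y → length (downFrom bound) ≤
                          # (λ l → miss? (y , l)) (downFrom bound) + (weight a y + weight b y)
        pointwise y = begin
          length levels
            ≡⟨ length≡∑1 levels ⟩
          ∑ levels (λ _ → 1)
            ≤⟨ ∑-mono levels (λ l → cases (l <? weight a y) (l <? weight b y)) ⟩
          ∑ levels (λ l → 𝟙 (miss? (y , l)) + (𝟙 (l <? weight a y) + 𝟙 (l <? weight b y)))
            ≡⟨ ∑-+ levels _ _ ⟩
          # (λ l → miss? (y , l)) levels + ∑ levels (λ l → 𝟙 (l <? weight a y) + 𝟙 (l <? weight b y))
            ≡⟨ cong (# (λ l → miss? (y , l)) levels +_) (∑-+ levels _ _) ⟩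
          # (λ l → miss? (y , l)) levels + (# (_<? weight a y) levels + # (_<? weight b y) levels)
            ≤⟨ +-monoʳ-≤ (# (λ l → miss? (y , l)) levels) (+-mono-≤ (below a) (below b)) ⟩
          # (λ l → miss? (y , l)) levels + (weight a y + weight b y) ∎
          where
          levels = downFrom bound
          below : ∀ c → # (_<? weight c y) levels ≤ weight c y
          below c = ≤-trans (≤-reflexive (#-<-downFrom (weight c y) bound)) (m⊓n≤m _ _)

      -- A hit succeeds whatever the later rounds do, and a miss succeeds whenever they do. No
      -- proposal is both, so the two counts add up.
      #success-suc : ∀ t → # hit? proposals * length (rounds t) + # miss? proposals * # success? (rounds t)
                           ≤ # success? (rounds (suc t))
      #success-suc t = begin
        # hit? proposals * length gs + # miss? proposals * # success? gs
          ≡⟨ cong₂ _+_ (∑-*ʳ proposals _ (length gs)) (∑-*ʳ proposals _ (# success? gs)) ⟨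
        ∑ proposals (λ d → 𝟙 (hit? d) * length gs) + ∑ proposals (λ d → 𝟙 (miss? d) * # success? gs)
          ≡⟨ ∑-+ proposals _ _ ⟨
        ∑ proposals (λ d → 𝟙 (hit? d) * length gs + 𝟙 (miss? d) * # success? gs)
          ≤⟨ ∑-mono proposals (λ d → pointwise d (hit? d) (miss? d)) ⟩
        ∑ proposals (λ d → # (λ g → success? (override d g)) gs)
          ≡⟨ ∑-cartesianProductWith override proposals gs _ ⟨
        # success? (rounds (suc t)) ∎
        where
        gs = rounds t
        accepts : ∀ {y l} → Hit (y , l) → ∀ g → Success (override (y , l) g)
        accepts {y} {l} (q , l<w) g =
          trans ya (sym yb) , subst Q (sym ya) q
          where
          ya = override-accept g (≤-trans l<w (m⊓n≤m _ _))
          yb = override-accept g (≤-trans l<w (m⊓n≤n _ _))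
        defers : ∀ {y l} → Miss (y , l) → ∀ g → Success g → Success (override (y , l) g)
        defers (l≮a , l≮b) g (agree , q) =
          trans ga (trans agree (sym gb)) , subst Q (sym ga) q
          where
          ga = override-reject g l≮a
          gb = override-reject g l≮b
        pointwise : ∀ d (h : Dec (Hit d)) (m : Dec (Miss d)) →
          𝟙 h * length gs + 𝟙 m * # success? gs ≤ # (λ g → success? (override d g)) gs
        pointwise d (yes h) (yes (l≮a , _)) = contradiction (≤-trans (proj₂ h) (m⊓n≤m _ _)) l≮a
        pointwise d (yes h) (no _) = ≤-reflexive (begin-equality
          1 * length gs + 0                    ≡⟨ trans (+-identityʳ _) (*-identityˡ _) ⟩
          length gs                            ≡⟨ #-all (λ g → success? (override d g)) gs (accepts h) ⟨
          # (λ g → success? (override d g)) gs ∎)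
        pointwise d (no _) (no _) = z≤n
        pointwise d (no _) (yes m) = begin
          1 * # success? gs                    ≡⟨ *-identityˡ _ ⟩
          # success? gs                        ≤⟨ #-mono success? (λ g → success? (override d g)) gs (defers m) ⟩
          # (λ g → success? (override d g)) gs ∎

      -- With G = `shared`, J = `total` and M proposals this says that t rounds succeed with
      -- probability at least tG/(M + tJ). Iterating the recursion for G hits and M - J misses gives
      -- (G/J)(1 - (1 - J/M)^t); the bound replaces 1 - (1-x)^t by the smaller tx/(1+tx), which has
      -- the same limit and a polynomial induction step.
      #success-lower : ∀ t → t * shared * length proposals ^ t ≤
                             # success? (rounds t) * (length proposals + t * total)
      #success-lower zero    = z≤n
      #success-lower (suc t) = begin
        suc t * G * (M * R)
          ≡⟨ rearrange₁ t G M R ⟩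
        G * R * (M + t * M)
          ≤⟨ *-monoʳ-≤ (G * R) (+-monoʳ-≤ M (*-monoʳ-≤ t #proposals≤#miss+total)) ⟩
        G * R * (M + t * (O + J))
          -- This slack, and `O * N * J` further on, raise the factor `M + t * J` to
          -- `M + suc t * J`.
          ≤⟨ m≤m+n _ (G * R * J) ⟩
        G * R * (M + t * (O + J)) + G * R * J
          ≡⟨ rearrange₂ t G M R O J ⟩
        G * R * (M + suc t * J) + O * (t * G * R)
          ≤⟨ +-monoʳ-≤ (G * R * (M + suc t * J)) (*-monoʳ-≤ O (#success-lower t)) ⟩
        G * R * (M + suc t * J) + O * (N * (M + t * J))
          ≤⟨ m≤m+n _ (O * N * J) ⟩
        G * R * (M + suc t * J) + O * (N * (M + t * J)) + O * N * J
          ≡⟨ rearrange₃ t G M R O J N ⟩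
        (G * R + O * N) * (M + suc t * J)
          ≤⟨ *-monoˡ-≤ (M + suc t * J) (+-monoˡ-≤ (O * N) (*-monoˡ-≤ R shared≤#hit)) ⟩
        (# hit? proposals * R + O * N) * (M + suc t * J)
          ≡⟨ cong (λ r → (# hit? proposals * r + O * N) * (M + suc t * J)) (length-rounds t) ⟨
        (# hit? proposals * length (rounds t) + O * N) * (M + suc t * J)
          ≤⟨ *-monoˡ-≤ (M + suc t * J) (#success-suc t) ⟩
        # success? (rounds (suc t)) * (M + suc t * J) ∎
        where
        G = shared
        J = total
        M = length proposals
        R = length proposals ^ t
        N = # success? (rounds t)
        O = # miss? proposals
        rearrange₁ : ∀ t G M R → suc t * G * (M * R) ≡ G * R * (M + t * M)
        rearrange₁ = solve-∀
        rearrange₂ : ∀ t G M R O J → G * R * (M + t * (O + J)) + G * R * J ≡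
                                     G * R * (M + suc t * J) + O * (t * G * R)
        rearrange₂ = solve-∀
        rearrange₃ : ∀ t G M R O J N → G * R * (M + suc t * J) + O * (N * (M + t * J)) + O * N * J ≡
                                       (G * R + O * N) * (M + suc t * J)
        rearrange₃ = solve-∀

      -- Since T exceeds the number M of proposals, TG/(M + TJ) ≥ G/(1 + J): stopping early costs no
      -- more than an increase of `total` by one.
      #success-enoughRounds : shared * length (rounds enoughRounds) ≤
                              # success? (rounds enoughRounds) * suc total
      #success-enoughRounds = *-cancelˡ-≤ T (begin
        T * (shared * length (rounds T))  ≡⟨ *-assoc T shared _ ⟨
        T * shared * length (rounds T)    ≡⟨ cong (T * shared *_) (length-rounds T) ⟩
        T * shared * length proposals ^ T ≤⟨ #success-lower T ⟩
        N * (length proposals + T * total) ≤⟨ *-monoʳ-≤ N (+-monoˡ-≤ (T * total) (n≤1+n (length proposals))) ⟩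
        N * (T + T * total)                ≡⟨ rearrange N T total ⟩
        T * (N * suc total)                ∎)
        where
        T = enoughRounds
        N = # success? (rounds T)
        rearrange : ∀ N T J → N * (T + T * J) ≡ T * (N * suc J)
        rearrange = solve-∀
-- Product weights on the cube

addresses : ∀ k → List (Address k)
addresses zero    = [] ∷ []
addresses (suc k) = map (true ∷_) (addresses k) ++ map (false ∷_) (addresses k)

∑-addresses : ∀ k (f : Address (suc k) → ℕ) →
  ∑ (addresses (suc k)) f ≡ ∑ (addresses k) (f ∘ (true ∷_)) + ∑ (addresses k) (f ∘ (false ∷_))
∑-addresses k f = begin
  ∑ (map (true ∷_) (addresses k) ++ map (false ∷_) (addresses k)) f
    ≡⟨ ∑-++ (map (true ∷_) (addresses k)) _ f ⟩
  ∑ (map (true ∷_) (addresses k)) f + ∑ (map (false ∷_) (addresses k)) f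
    ≡⟨ cong₂ _+_ (∑-map (true ∷_) (addresses k) f) (∑-map (false ∷_) (addresses k) f) ⟩
  ∑ (addresses k) (f ∘ (true ∷_)) + ∑ (addresses k) (f ∘ (false ∷_)) ∎
  where open ≡-Reasoning

module ProductWeights (m : ℕ) where

  factor : Bool → Bool → ℕ
  factor x y = if x xor y then m else suc m

  -- The square root of the unnormalised product measure: the coordinates of c
  -- agree with those of a independently with probability (m+1)²/w.
  amplitude : ∀ {k} → Address k → Address k → ℕ
  amplitude []      []      = 1
  amplitude (x ∷ a) (y ∷ c) = factor x y * amplitude a c

  mass : ∀ {k} → Address k → Address k → ℕ
  mass a c = amplitude a c * amplitude a c

  -- w = m² + (m+1)²
  u w : ℕ
  u = 2 * (m * suc m)
  w = suc u

  factor≤ : ∀ x y → factor x y ≤ suc m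
  factor≤ x y with x xor y
  ... | true  = n≤1+n m
  ... | false = ≤-refl

  amplitude≤ : ∀ {k} (a c : Address k) → amplitude a c ≤ suc m ^ k
  amplitude≤ []      []      = ≤-refl
  amplitude≤ (x ∷ a) (y ∷ c) = *-mono-≤ (factor≤ x y) (amplitude≤ a c)

  -- `w ^ k` times the Bhattacharyya coefficient of the two normalised measures.
  fidelity : ∀ {k} → Address k → Address k → ℕ
  fidelity {k} a b = ∑ (addresses k) (λ c → amplitude a c * amplitude b c)

  fidelity-∷ : ∀ {k} x y (a b : Address k) → fidelity (x ∷ a) (y ∷ b) ≡
    (factor x true * factor y true + factor x false * factor y false) * fidelity a b
  fidelity-∷ {k} x y a b = begin
    fidelity (x ∷ a) (y ∷ b)
      ≡⟨ ∑-addresses k _ ⟩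
    ∑ (addresses k) (λ c → factor x true * amplitude a c * (factor y true * amplitude b c)) +
    ∑ (addresses k) (λ c → factor x false * amplitude a c * (factor y false * amplitude b c))
      ≡⟨ cong₂ _+_ (pull true) (pull false) ⟩
    factor x true * factor y true * fidelity a b + factor x false * factor y false * fidelity a b
      ≡⟨ *-distribʳ-+ (fidelity a b) (factor x true * factor y true) _ ⟨
    (factor x true * factor y true + factor x false * factor y false) * fidelity a b ∎
    where
    open ≡-Reasoning
    rearrange : ∀ p q r s → p * q * (r * s) ≡ p * r * (q * s)
    rearrange = solve-∀
    pull : ∀ z → ∑ (addresses k) (λ c → factor x z * amplitude a c * (factor y z * amplitude b c)) ≡
                 factor x z * factor y z * fidelity a b
    pull z = trans (∑-cong (addresses k) (λ c → rearrange (factor x z) (amplitude a c) (factor y z) (amplitude b c)))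
                   (∑-*ˡ (addresses k) (factor x z * factor y z) _)

  -- The sum factorises over the coordinates: an agreeing one contributes (m+1)² + m² = w, a
  -- differing one 2m(m+1) = u. The power of w on the left clears the denominator of (u/w)^d.
  fidelity-hamming : ∀ {k} (a b : Address k) → w ^ hamming a b * fidelity a b ≡ u ^ hamming a b * w ^ k
  fidelity-hamming []      []      = refl
  fidelity-hamming {suc k} (x ∷ a) (y ∷ b) rewrite fidelity-∷ x y a b = cases x y
    where
    open ≡-Reasoning
    d = hamming a b
    s = fidelity a b
    agreeing : ∀ {v} → v ≡ w → w ^ d * (v * s) ≡ u ^ d * w ^ suc k
    agreeing refl = begin
      w ^ d * (w * s)      ≡⟨ swap (w ^ d) w s ⟩
      w * (w ^ d * s)      ≡⟨ cong (w *_) (fidelity-hamming a b) ⟩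
      w * (u ^ d * w ^ k)  ≡⟨ swap w (u ^ d) (w ^ k) ⟩
      u ^ d * w ^ suc k    ∎
      where
      swap : ∀ p q r → p * (q * r) ≡ q * (p * r)
      swap = solve-∀
    differing : ∀ {v} → v ≡ u → w ^ suc d * (v * s) ≡ u ^ suc d * w ^ suc k
    differing refl = begin
      w * w ^ d * (u * s)      ≡⟨ regroup w (w ^ d) u s ⟩
      w * u * (w ^ d * s)      ≡⟨ cong (w * u *_) (fidelity-hamming a b) ⟩
      w * u * (u ^ d * w ^ k)  ≡⟨ regroup′ w u (u ^ d) (w ^ k) ⟩
      u * u ^ d * (w * w ^ k)  ∎
      where
      regroup : ∀ p q r t → p * q * (r * t) ≡ p * r * (q * t)
      regroup = solve-∀
      regroup′ : ∀ p q r t → p * q * (r * t) ≡ q * r * (p * t)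
      regroup′ = solve-∀
    sum-of-squares : ∀ m → suc m * suc m + m * m ≡ suc (2 * (m * suc m))
    sum-of-squares = solve-∀
    sum-of-squares′ : ∀ m → m * m + suc m * suc m ≡ suc (2 * (m * suc m))
    sum-of-squares′ = solve-∀
    sum-of-products : ∀ m → suc m * m + m * suc m ≡ 2 * (m * suc m)
    sum-of-products = solve-∀
    sum-of-products′ : ∀ m → m * suc m + suc m * m ≡ 2 * (m * suc m)
    sum-of-products′ = solve-∀
    cases : ∀ x y → w ^ hamming (x ∷ a) (y ∷ b) *
              ((factor x true * factor y true + factor x false * factor y false) * s) ≡
            u ^ hamming (x ∷ a) (y ∷ b) * w ^ suc k
    cases true  true  = agreeing (sum-of-squares m)
    cases true  false = differing (sum-of-products m)
    cases false true  = differing (sum-of-products′ m)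
    cases false false = agreeing (sum-of-squares′ m)

  -- Binomial moments of the Hamming distance and Chebyshev's inequality

  moment : ∀ {k} → (ℕ → ℕ) → Address k → ℕ
  moment {k} f a = ∑ (addresses k) (λ c → mass a c * f (hamming a c))

  -- After division by w, the probabilities that a coordinate agrees and that it differs.
  p q : ℕ
  p = suc m * suc m
  q = m * m

  p+q≡w : p + q ≡ w
  p+q≡w = expand m
    where
    expand : ∀ m → suc m * suc m + m * m ≡ suc (2 * (m * suc m))
    expand = solve-∀

  -- A differing first coordinate shifts the distance by one. This recursion is why `moment` takes
  -- an arbitrary function instead of an exponent.
  moment-∷ : ∀ {k} f x (a : Address k) → moment f (x ∷ a) ≡ p * moment f a + q * moment (f ∘ suc) a
  moment-∷ {k} f x a = trans (∑-addresses k _) (cases x)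
    where
    square-* : ∀ e s t → e * s * (e * s) * t ≡ e * e * (s * s * t)
    square-* = solve-∀
    pull : ∀ e (h : Address k → ℕ) →
      ∑ (addresses k) (λ c → e * amplitude a c * (e * amplitude a c) * h c) ≡
      e * e * ∑ (addresses k) (λ c → mass a c * h c)
    pull e h = trans (∑-cong (addresses k) (λ c → square-* e (amplitude a c) (h c)))
                     (∑-*ˡ (addresses k) (e * e) _)
    cases : ∀ x →
      ∑ (addresses k) (λ c → mass (x ∷ a) (true ∷ c) * f (hamming (x ∷ a) (true ∷ c))) +
      ∑ (addresses k) (λ c → mass (x ∷ a) (false ∷ c) * f (hamming (x ∷ a) (false ∷ c))) ≡
      p * moment f a + q * moment (f ∘ suc) a
    cases true  = cong₂ _+_ (pull (suc m) (f ∘ hamming a)) (pull m (f ∘ suc ∘ hamming a))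
    cases false = trans (cong₂ _+_ (pull m (f ∘ suc ∘ hamming a)) (pull (suc m) (f ∘ hamming a)))
                        (+-comm (q * moment (f ∘ suc) a) _)

  moment-+ : ∀ {k} f g (a : Address k) → moment (λ h → f h + g h) a ≡ moment f a + moment g a
  moment-+ {k} f g a = trans (∑-cong (addresses k) (λ c → *-distribˡ-+ (mass a c) (f (hamming a c)) _))
                             (∑-+ (addresses k) _ _)

  moment-*ˡ : ∀ {k} e f (a : Address k) → moment (λ h → e * f h) a ≡ e * moment f a
  moment-*ˡ {k} e f a = trans (∑-cong (addresses k) (λ c → swap (mass a c) e (f (hamming a c))))
                              (∑-*ˡ (addresses k) e _)
    where
    swap : ∀ p q r → p * (q * r) ≡ q * (p * r)
    swap = solve-∀

  moment-cong : ∀ {k f g} (a : Address k) → (∀ h → f h ≡ g h) → moment f a ≡ moment g a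
  moment-cong {k} a f≡g = ∑-cong (addresses k) (λ c → cong (mass a c *_) (f≡g (hamming a c)))

  moment₀ : ∀ {k} (a : Address k) → moment (λ _ → 1) a ≡ w ^ k
  moment₀ []          = refl
  moment₀ {suc k} (x ∷ a) = begin
    moment (λ _ → 1) (x ∷ a)                          ≡⟨ moment-∷ _ x a ⟩
    p * moment (λ _ → 1) a + q * moment (λ _ → 1) a   ≡⟨ *-distribʳ-+ (moment (λ _ → 1) a) p q ⟨
    (p + q) * moment (λ _ → 1) a                      ≡⟨ cong₂ _*_ p+q≡w (moment₀ a) ⟩
    w * w ^ k                                         ∎
    where open ≡-Reasoning

  moment₁ : ∀ {k} (a : Address k) → w * moment id a ≡ k * q * w ^ k
  moment₁ []              = *-zeroʳ w
  moment₁ {suc k} (x ∷ a) = begin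
    w * moment id (x ∷ a)
      ≡⟨ cong (w *_) (moment-∷ id x a) ⟩
    w * (p * F + q * moment suc a)
      ≡⟨ cong (λ z → w * (p * F + q * z)) (moment-+ (λ _ → 1) id a) ⟩
    w * (p * F + q * (moment (λ _ → 1) a + F))
      ≡⟨ cong (λ z → w * (p * F + q * (z + F))) (moment₀ a) ⟩
    w * (p * F + q * (W + F))
      ≡⟨ expand w p q F W ⟩
    (p + q) * (w * F) + q * (w * W)
      ≡⟨ cong₂ (λ y z → y * z + q * (w * W)) p+q≡w (moment₁ a) ⟩
    w * (k * q * W) + q * (w * W)
      ≡⟨ collect w k q W ⟩
    suc k * q * (w * W) ∎
    where
    open ≡-Reasoning
    F = moment id a
    W = w ^ k
    expand : ∀ w p q F W → w * (p * F + q * (W + F)) ≡ (p + q) * (w * F) + q * (w * W)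
    expand = solve-∀
    collect : ∀ w k q W → w * (k * q * W) + q * (w * W) ≡ suc k * q * (w * W)
    collect = solve-∀

  -- The distance is binomial with parameters k and q/w. Cleared of the denominator w², its variance
  -- is `k * p * q`, and the other summand is its squared mean.
  moment₂ : ∀ {k} (a : Address k) →
    w * w * moment (λ h → h * h) a ≡ (k * p * q + k * q * (k * q)) * w ^ k
  moment₂ []              = *-zeroʳ (w * w)
  moment₂ {suc k} (x ∷ a) = begin
    w * w * moment (λ h → h * h) (x ∷ a)
      ≡⟨ cong (w * w *_) (moment-∷ (λ h → h * h) x a) ⟩
    w * w * (p * S + q * moment (λ h → suc h * suc h) a)
      ≡⟨ cong (λ z → w * w * (p * S + q * z)) shifted ⟩
    w * w * (p * S + q * (S + (2 * F + W)))
      ≡⟨ expand w p q S F W ⟩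
    (p + q) * (w * w * S) + (2 * w * q * (w * F) + q * w * w * W)
      ≡⟨ cong₂ (λ y z → y * z + (2 * w * q * (w * F) + q * w * w * W)) p+q≡w (moment₂ a) ⟩
    w * ((k * p * q + k * q * (k * q)) * W) + (2 * w * q * (w * F) + q * w * w * W)
      ≡⟨ cong₂ (λ y z → w * ((k * p * q + k * q * (k * q)) * W) + (2 * w * q * y + q * w * z * W))
               (moment₁ a) (sym p+q≡w) ⟩
    w * ((k * p * q + k * q * (k * q)) * W) + (2 * w * q * (k * q * W) + q * w * (p + q) * W)
      ≡⟨ collect w k p q W ⟩
    (suc k * p * q + suc k * q * (suc k * q)) * (w * W) ∎
    where
    open ≡-Reasoning
    S = moment (λ h → h * h) a
    F = moment id a
    W = w ^ k
    square-suc : ∀ h → suc h * suc h ≡ h * h + (2 * h + 1)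
    square-suc = solve-∀
    shifted : moment (λ h → suc h * suc h) a ≡ S + (2 * F + W)
    shifted = begin
      moment (λ h → suc h * suc h) a            ≡⟨ moment-cong a square-suc ⟩
      moment (λ h → h * h + (2 * h + 1)) a      ≡⟨ moment-+ (λ h → h * h) (λ h → 2 * h + 1) a ⟩
      S + moment (λ h → 2 * h + 1) a            ≡⟨ cong (S +_) (moment-+ (2 *_) (λ _ → 1) a) ⟩
      S + (moment (2 *_) a + moment (λ _ → 1) a)
        ≡⟨ cong (S +_) (cong₂ _+_ (moment-*ˡ 2 id a) (moment₀ a)) ⟩
      S + (2 * F + W) ∎
    expand : ∀ w p q S F W → w * w * (p * S + q * (S + (2 * F + W))) ≡
                             (p + q) * (w * w * S) + (2 * w * q * (w * F) + q * w * w * W)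
    expand = solve-∀
    collect : ∀ w k p q W →
      w * ((k * p * q + k * q * (k * q)) * W) + (2 * w * q * (k * q * W) + q * w * (p + q) * W) ≡
      (suc k * p * q + suc k * q * (suc k * q)) * (w * W)
    collect = solve-∀

  -- The factor w clears the denominator of k q / w, the mean of hamming a c.
  chebyshev : ∀ {k} (a : Address k) {Far : Address k → Set} (far? : Decidable Far) θ →
    (∀ c → Far c → θ + 2 * (w * hamming a c) * (k * q) ≤
                   w * hamming a c * (w * hamming a c) + k * q * (k * q)) →
    θ * ∑ (addresses k) (λ c → 𝟙 (far? c) * mass a c) ≤ k * p * q * w ^ k
  -- The cross term of (w h - k q)² is negative. It is kept on the left side, where `moment₁` gives
  -- its sum, and cancelled.
  chebyshev {k} a {Far} far? θ deviates = +-cancelʳ-≤ (2 * (k * q * (k * q)) * W) _ _ (begin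
    θ * ∑ cs (λ c → 𝟙 (far? c) * mass a c) + 2 * (k * q * (k * q)) * W
      ≡⟨ cong₂ _+_ (sym (∑-*ˡ cs θ _)) cross ⟩
    ∑ cs (λ c → θ * (𝟙 (far? c) * mass a c)) + moment (λ h → 2 * (k * q) * (w * h)) a
      ≡⟨ ∑-+ cs _ _ ⟨
    ∑ cs (λ c → θ * (𝟙 (far? c) * mass a c) + mass a c * (2 * (k * q) * (w * hamming a c)))
      ≤⟨ ∑-mono cs (λ c → pointwise c (far? c)) ⟩
    moment (λ h → w * w * (h * h) + k * q * (k * q) * 1) a
      ≡⟨ moment-+ (λ h → w * w * (h * h)) (λ _ → k * q * (k * q) * 1) a ⟩
    moment (λ h → w * w * (h * h)) a + moment (λ _ → k * q * (k * q) * 1) a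
      ≡⟨ cong₂ _+_ (moment-*ˡ (w * w) (λ h → h * h) a) (moment-*ˡ (k * q * (k * q)) (λ _ → 1) a) ⟩
    w * w * moment (λ h → h * h) a + k * q * (k * q) * moment (λ _ → 1) a
      ≡⟨ cong₂ (λ y z → y + k * q * (k * q) * z) (moment₂ a) (moment₀ a) ⟩
    (k * p * q + k * q * (k * q)) * W + k * q * (k * q) * W
      ≡⟨ collect (k * p * q) (k * q * (k * q)) W ⟩
    k * p * q * W + 2 * (k * q * (k * q)) * W ∎)
    where
    open ≤-Reasoning
    cs = addresses k
    W = w ^ k
    collect : ∀ v s W → (v + s) * W + s * W ≡ v * W + 2 * s * W
    collect = solve-∀
    cross : 2 * (k * q * (k * q)) * W ≡ moment (λ h → 2 * (k * q) * (w * h)) a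
    cross = begin-equality
      2 * (k * q * (k * q)) * W             ≡⟨ regroup (k * q) W ⟩
      2 * (k * q) * (k * q * W)             ≡⟨ cong (2 * (k * q) *_) (moment₁ a) ⟨
      2 * (k * q) * (w * moment id a)       ≡⟨ cong (2 * (k * q) *_) (moment-*ˡ w id a) ⟨
      2 * (k * q) * moment (w *_) a         ≡⟨ moment-*ˡ (2 * (k * q)) (w *_) a ⟨
      moment (λ h → 2 * (k * q) * (w * h)) a ∎
      where
      regroup : ∀ s W → 2 * (s * s) * W ≡ 2 * s * (s * W)
      regroup = solve-∀
    pointwise : ∀ c (f : Dec (Far c)) →
      θ * (𝟙 f * mass a c) + mass a c * (2 * (k * q) * (w * hamming a c)) ≤
      mass a c * (w * w * (hamming a c * hamming a c) + k * q * (k * q) * 1)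
    pointwise c (yes f) = begin
      θ * (1 * n) + n * (2 * (k * q) * (w * h))
        ≡⟨ regroup θ n (k * q) (w * h) ⟩
      n * (θ + 2 * (w * h) * (k * q))
        ≤⟨ *-monoʳ-≤ n (deviates c f) ⟩
      n * (w * h * (w * h) + k * q * (k * q))
        ≡⟨ regroup′ n w h (k * q) ⟩
      n * (w * w * (h * h) + k * q * (k * q) * 1) ∎
      where
      n = mass a c
      h = hamming a c
      regroup : ∀ θ n s t → θ * (1 * n) + n * (2 * s * t) ≡ n * (θ + 2 * t * s)
      regroup = solve-∀
      regroup′ : ∀ n w h s → n * (w * h * (w * h) + s * s) ≡ n * (w * w * (h * h) + s * s * 1)
      regroup′ = solve-∀
    -- Only the cross term is left here, and (w h - k q)² ≥ 0 bounds it.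
    pointwise c (no _) = begin
      θ * 0 + n * (2 * (k * q) * (w * h))   ≡⟨ cong (_+ n * (2 * (k * q) * (w * h))) (*-zeroʳ θ) ⟩
      n * (2 * (k * q) * (w * h))           ≤⟨ *-monoʳ-≤ n (2ab≤a²+b² (k * q) (w * h)) ⟩
      n * (k * q * (k * q) + w * h * (w * h)) ≡⟨ regroup n w h (k * q) ⟩
      n * (w * w * (h * h) + k * q * (k * q) * 1) ∎
      where
      n = mass a c
      h = hamming a c
      regroup : ∀ n w h s → n * (s * s + w * h * (w * h)) ≡ n * (w * w * (h * h) + s * s * 1)
      regroup = solve-∀

  -- Summed over all points: 1 - TV ≥ fidelity - 1/2 for probability measures
  -- with densities x² and y².
  minOfSquares : ∀ x y → 4 * (x * y) ≤ 4 * ((x * x) ⊓ (y * y)) + (x * x + y * y)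
  minOfSquares x y with ≤-total x y
  ... | inj₁ x≤y = ≤-trans (smaller x y) (≤-reflexive (cong (λ z → 4 * z + (x * x + y * y))
                     (sym (m≤n⇒m⊓n≡m {x * x} {y * y} (*-mono-≤ x≤y x≤y)))))
    where
    -- From (2x - y)² ≥ 0.
    smaller : ∀ x y → 4 * (x * y) ≤ 4 * (x * x) + (x * x + y * y)
    smaller x y = begin
      4 * (x * y)                       ≡⟨ regroup x y ⟩
      2 * (2 * x) * y                   ≤⟨ 2ab≤a²+b² (2 * x) y ⟩
      2 * x * (2 * x) + y * y           ≤⟨ m≤n+m _ (x * x) ⟩
      x * x + (2 * x * (2 * x) + y * y) ≡⟨ regroup′ x y ⟩
      4 * (x * x) + (x * x + y * y)     ∎
      where
      open ≤-Reasoning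
      regroup : ∀ x y → 4 * (x * y) ≡ 2 * (2 * x) * y
      regroup = solve-∀
      regroup′ : ∀ x y → x * x + (2 * x * (2 * x) + y * y) ≡ 4 * (x * x) + (x * x + y * y)
      regroup′ = solve-∀
  ... | inj₂ y≤x = ≤-trans (larger x y) (≤-reflexive (cong (λ z → 4 * z + (x * x + y * y))
                     (sym (m≥n⇒m⊓n≡n {x * x} {y * y} (*-mono-≤ y≤x y≤x)))))
    where
    larger : ∀ x y → 4 * (x * y) ≤ 4 * (y * y) + (x * x + y * y)
    larger x y = begin
      4 * (x * y)                       ≡⟨ regroup x y ⟩
      2 * (2 * y) * x                   ≤⟨ 2ab≤a²+b² (2 * y) x ⟩
      2 * y * (2 * y) + x * x           ≤⟨ m≤n+m _ (y * y) ⟩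
      y * y + (2 * y * (2 * y) + x * x) ≡⟨ regroup′ x y ⟩
      4 * (y * y) + (x * x + y * y)     ∎
      where
      open ≤-Reasoning
      regroup : ∀ x y → 4 * (x * y) ≡ 2 * (2 * y) * x
      regroup = solve-∀
      regroup′ : ∀ x y → y * y + (2 * y * (2 * y) + x * x) ≡ 4 * (y * y) + (x * x + y * y)
      regroup′ = solve-∀

  -- (1 - 1/w)^d ≥ 1 - d/w, multiplied by w^(d+1); note u = w - 1.
  bernoulli : ∀ d → w * w ^ d ≤ w * u ^ d + d * w ^ d
  bernoulli zero    = m≤m+n (w * 1) 0
  bernoulli (suc d) = begin
    w * (w * w ^ d)                      ≤⟨ *-monoʳ-≤ w (bernoulli d) ⟩
    w * (w * u ^ d + d * w ^ d)          ≡⟨ expand u (u ^ d) d (w ^ d) ⟩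
    w * (u * u ^ d) + (w * u ^ d + d * (w * w ^ d))
      ≤⟨ +-monoʳ-≤ (w * (u * u ^ d)) (+-monoˡ-≤ (d * (w * w ^ d)) (*-monoʳ-≤ w (^-monoˡ-≤ d (n≤1+n u)))) ⟩
    w * u ^ suc d + suc d * w ^ suc d ∎
    where
    open ≤-Reasoning
    expand : ∀ u U d V → suc u * (suc u * U + d * V) ≡ suc u * (u * U) + (suc u * U + d * (suc u * V))
    expand = solve-∀

  fidelity-lower : ∀ {k} (a b : Address k) → 4 * hamming a b ≤ w → 3 * w ^ k ≤ 4 * fidelity a b
  fidelity-lower {k} a b 4d≤w =
    *-cancelˡ-≤ (w ^ d) {{m^n≢0 w d}} (*-cancelˡ-≤ w (+-cancelʳ-≤ (w * D * W) _ _ (begin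
      w * (D * (3 * W)) + w * D * W        ≡⟨ collect w D W ⟩
      4 * W * (w * D)                      ≤⟨ *-monoʳ-≤ (4 * W) (bernoulli d) ⟩
      4 * W * (w * U + d * D)              ≡⟨ expand W w U d D ⟩
      4 * w * (U * W) + 4 * d * (D * W)    ≤⟨ +-monoʳ-≤ (4 * w * (U * W)) (*-monoˡ-≤ (D * W) 4d≤w) ⟩
      4 * w * (U * W) + w * (D * W)        ≡⟨ cong (λ z → 4 * w * z + w * (D * W)) (fidelity-hamming a b) ⟨
      4 * w * (D * s) + w * (D * W)        ≡⟨ regroup w D s W ⟩
      w * (D * (4 * s)) + w * D * W        ∎)))
    where
    open ≤-Reasoning
    d = hamming a b
    s = fidelity a b
    D = w ^ d
    U = u ^ d
    W = w ^ k
    collect : ∀ w D W → w * (D * (3 * W)) + w * D * W ≡ 4 * W * (w * D)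
    collect = solve-∀
    expand : ∀ W w U d D → 4 * W * (w * U + d * D) ≡ 4 * w * (U * W) + 4 * d * (D * W)
    expand = solve-∀
    regroup : ∀ w D s W → 4 * w * (D * s) + w * (D * W) ≡ w * (D * (4 * s)) + w * D * W
    regroup = solve-∀

  ∑-mass₂ : ∀ {k} (a b : Address k) → ∑ (addresses k) (λ c → mass a c + mass b c) ≡ w ^ k + w ^ k
  ∑-mass₂ {k} a b = trans (∑-+ (addresses k) _ _) (cong₂ _+_ (∑-mass a) (∑-mass b))
    where
    ∑-mass : ∀ (a : Address k) → ∑ (addresses k) (mass a) ≡ w ^ k
    ∑-mass a = trans (∑-cong (addresses k) (λ c → sym (*-identityʳ (mass a c)))) (moment₀ a)

  -- In units of `w ^ k`, fidelity 3/4 yields an overlap of at least 3/4 - 1/2 = 1/4. Removing the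
  -- part outside `Close` costs at most 1/16, which leaves 3/16 ≥ 1/8.
  shared-lower : ∀ {k} (a b : Address k) {Close : Address k → Set} (close? : Decidable Close) →
    4 * hamming a b ≤ w →
    16 * ∑ (addresses k) (λ c → 𝟙 (¬? (close? c)) * mass a c) ≤ w ^ k →
    w ^ k ≤ 8 * ∑ (addresses k) (λ c → 𝟙 (close? c) * (mass a c ⊓ mass b c))
  shared-lower {k} a b close? 4d≤w tail = *-cancelˡ-≤ 2 (+-cancelʳ-≤ (9 * W + W) _ _ (begin
      2 * W + (9 * W + W)                        ≡⟨ collect W ⟩
      4 * (3 * W)                                ≤⟨ *-monoʳ-≤ 4 (fidelity-lower a b 4d≤w) ⟩
      4 * (4 * fidelity a b)                     ≤⟨ *-monoʳ-≤ 4 fidelity-split ⟩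
      4 * (4 * G + 4 * T + (W + W))              ≡⟨ expand G T W ⟩
      2 * (8 * G) + (16 * T + 8 * W)             ≤⟨ +-monoʳ-≤ (2 * (8 * G)) (+-monoˡ-≤ (8 * W) tail) ⟩
      2 * (8 * G) + (W + 8 * W)                  ≤⟨ +-monoʳ-≤ (2 * (8 * G)) (m≤m+n (W + 8 * W) W) ⟩
      2 * (8 * G) + (9 * W + W)                  ∎))
    where
    open ≤-Reasoning
    cs = addresses k
    W = w ^ k
    G = ∑ cs (λ c → 𝟙 (close? c) * (mass a c ⊓ mass b c))
    T = ∑ cs (λ c → 𝟙 (¬? (close? c)) * mass a c)
    collect : ∀ W → 2 * W + (9 * W + W) ≡ 4 * (3 * W)
    collect = solve-∀
    expand : ∀ G T W → 4 * (4 * G + 4 * T + (W + W)) ≡ 2 * (8 * G) + (16 * T + 8 * W)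
    expand = solve-∀
    pointwise : ∀ {P : Set} (c? : Dec P) x y → 4 * (x * y) ≤
      4 * (𝟙 c? * ((x * x) ⊓ (y * y))) + 4 * (𝟙 (¬? c?) * (x * x)) + (x * x + y * y)
    pointwise (yes _) x y = begin
      4 * (x * y)                                   ≤⟨ minOfSquares x y ⟩
      4 * ((x * x) ⊓ (y * y)) + (x * x + y * y)         ≡⟨ pad ((x * x) ⊓ (y * y)) (x * x + y * y) ⟩
      4 * (1 * ((x * x) ⊓ (y * y))) + 4 * (0 * (x * x)) + (x * x + y * y) ∎
      where
      pad : ∀ s t → 4 * s + t ≡ 4 * (1 * s) + 0 + t
      pad = solve-∀
    pointwise (no _) x y = begin
      4 * (x * y)                                   ≤⟨ minOfSquares x y ⟩
      4 * ((x * x) ⊓ (y * y)) + (x * x + y * y)         ≤⟨ +-monoˡ-≤ (x * x + y * y) (*-monoʳ-≤ 4 (m⊓n≤m (x * x) (y * y))) ⟩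
      4 * (x * x) + (x * x + y * y)                 ≡⟨ pad (x * x) (x * x + y * y) ⟩
      4 * (0 * ((x * x) ⊓ (y * y))) + 4 * (1 * (x * x)) + (x * x + y * y) ∎
      where
      pad : ∀ s t → 4 * s + t ≡ 0 + 4 * (1 * s) + t
      pad = solve-∀
    fidelity-split : 4 * fidelity a b ≤ 4 * G + 4 * T + (W + W)
    fidelity-split = begin
      4 * fidelity a b
        ≡⟨ ∑-*ˡ cs 4 _ ⟨
      ∑ cs (λ c → 4 * (amplitude a c * amplitude b c))
        ≤⟨ ∑-mono cs (λ c → pointwise (close? c) (amplitude a c) (amplitude b c)) ⟩
      ∑ cs (λ c → 4 * (𝟙 (close? c) * (mass a c ⊓ mass b c)) + 4 * (𝟙 (¬? (close? c)) * mass a c) +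
                  (mass a c + mass b c))
        ≡⟨ trans (∑-+ cs _ _) (cong₂ _+_ (∑-+ cs _ _) (∑-mass₂ a b)) ⟩
      ∑ cs (λ c → 4 * (𝟙 (close? c) * (mass a c ⊓ mass b c))) + ∑ cs (λ c → 4 * (𝟙 (¬? (close? c)) * mass a c)) + (W + W)
        ≡⟨ cong (_+ (W + W)) (cong₂ _+_ (∑-*ˡ cs 4 _) (∑-*ˡ cs 4 _)) ⟩
      4 * G + 4 * T + (W + W) ∎

  -- A subtraction-free form of θ ≤ (A - B)², with A - B ≥ μ/4 and θ ≤ (μ/4)².
  deviation : ∀ A B μ θ → 4 * B + μ ≤ 4 * A → 16 * θ ≤ μ * μ → θ + 2 * A * B ≤ A * A + B * B
  deviation A B μ θ gap 16θ≤μ² with r , refl ← m≤n⇒∃[o]m+o≡n {B} {A} (*-cancelˡ-≤ 4 (≤-trans (m≤m+n (4 * B) μ) gap)) =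
    begin
      θ + 2 * (B + r) * B             ≤⟨ +-monoˡ-≤ (2 * (B + r) * B) θ≤r² ⟩
      r * r + 2 * (B + r) * B         ≡⟨ identity B r ⟩
      (B + r) * (B + r) + B * B       ∎
    where
    open ≤-Reasoning
    identity : ∀ B r → r * r + 2 * (B + r) * B ≡ (B + r) * (B + r) + B * B
    identity = solve-∀
    μ≤4r : μ ≤ 4 * r
    μ≤4r = +-cancelˡ-≤ (4 * B) _ _ (≤-trans gap (≤-reflexive (*-distribˡ-+ 4 B r)))
    square-4* : ∀ r → 4 * r * (4 * r) ≡ 16 * (r * r)
    square-4* = solve-∀
    θ≤r² : θ ≤ r * r
    θ≤r² = *-cancelˡ-≤ 16 (≤-trans 16θ≤μ² (≤-trans (*-mono-≤ μ≤4r μ≤4r) (≤-reflexive (square-4* r))))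

  -- The tail of the product measure outside the ball

  module _ {k L : ℕ} {{_ : NonZero k}} {{_ : NonZero L}}
           (k<2^ : k < 2 ^ suc L) (64wL≤k : 64 * w * L ≤ k) where
    open ≤-Reasoning

    -- As log₂ k < L + 1 ≤ 2L, the exact radius condition follows from one in which 2L stands for
    -- log₂ k.
    near-intro : ∀ (a c : Address k) → 2 * hamming a c ≤ k →
      8 * k * L ≤ (k ∸ 2 * hamming a c) * (k ∸ 2 * hamming a c) → Near a c
    near-intro a c 2h≤k bound = 2h≤k , (begin
      k ^ (4 * k)            ≤⟨ ^-monoˡ-≤ (4 * k) (<⇒≤ k<2^) ⟩
      (2 ^ suc L) ^ (4 * k)  ≡⟨ ^-*-assoc 2 (suc L) (4 * k) ⟩
      2 ^ (suc L * (4 * k))  ≤⟨ ^-monoʳ-≤ 2 exponent ⟩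
      2 ^ (X ^ 2)            ∎)
      where
      X = k ∸ 2 * hamming a c
      regroup : ∀ L k → (L + L) * (4 * k) ≡ 8 * k * L
      regroup = solve-∀
      exponent : suc L * (4 * k) ≤ X ^ 2
      exponent = begin
        suc L * (4 * k)     ≤⟨ *-monoˡ-≤ (4 * k) (+-monoˡ-≤ L (>-nonZero⁻¹ L)) ⟩
        (L + L) * (4 * k)   ≡⟨ regroup L k ⟩
        8 * k * L           ≤⟨ bound ⟩
        X * X               ≡⟨ cong (X *_) (*-identityʳ X) ⟨
        X ^ 2               ∎

    -- w times the mean of k - 2 hamming a c, for c drawn from mass a
    μ : ℕ
    μ = k * suc (2 * m)

    2wk≡4kq+2μ : 2 * w * k ≡ 4 * (k * q) + 2 * μ
    2wk≡4kq+2μ = identity k m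
      where
      identity : ∀ k m → 2 * suc (2 * (m * suc m)) * k ≡ 4 * (k * (m * m)) + 2 * (k * suc (2 * m))
      identity = solve-∀

    -- Because (2m+1)² = 2w - 1 ≥ w, μ² is at least k²w. The constant 64 is 16 · 4, as the threshold
    -- 4w²k of `far-deviates` demands; placing the edge of the ball at half the mean takes 4w² · 8kL
    -- = 32w²kL.
    64w²kL≤μ² : 64 * (w * w * k * L) ≤ μ * μ
    64w²kL≤μ² = begin
      64 * (w * w * k * L)     ≡⟨ regroup w k L ⟩
      64 * w * L * (k * w)     ≤⟨ *-mono-≤ 64wL≤k (*-monoʳ-≤ k (s≤s (m≤m+n u u))) ⟩
      k * (k * suc (u + u))    ≡⟨ identity k m ⟩
      μ * μ                    ∎
      where
      regroup : ∀ w k L → 64 * (w * w * k * L) ≡ 64 * w * L * (k * w)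
      regroup = solve-∀
      identity : ∀ k m → k * (k * suc (2 * (m * suc m) + 2 * (m * suc m))) ≡
                         k * suc (2 * m) * (k * suc (2 * m))
      identity = solve-∀

    -- The mean of k - 2h is μ/w, and at a far point k - 2h is at most half of it. So h is off its
    -- own mean by at least μ/(4w).
    far-deviates : ∀ (a c : Address k) → ¬ Near a c →
      4 * (w * w * k) + 2 * (w * hamming a c) * (k * q) ≤
      w * hamming a c * (w * hamming a c) + k * q * (k * q)
    far-deviates a c far = deviation (w * h) (k * q) μ (4 * (w * w * k)) gap (begin
        16 * (4 * (w * w * k))  ≡⟨ *-assoc 16 4 (w * w * k) ⟨
        64 * (w * w * k)        ≤⟨ *-monoʳ-≤ 64 (m≤m*n (w * w * k) L) ⟩
        64 * (w * w * k * L)    ≤⟨ 64w²kL≤μ² ⟩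
        μ * μ                   ∎)
      where
      h = hamming a c
      X = k ∸ 2 * h
      regroup : ∀ w h → 2 * w * (2 * h) ≡ 4 * (w * h)
      regroup = solve-∀
      gap : 4 * (k * q) + μ ≤ 4 * (w * h)
      gap with 2 * h ≤? k
      -- Here `X` is truncated to zero, but h exceeds k/2, which already lies μ/(2w) above the mean.
      ... | no 2h≰k = begin
        4 * (k * q) + μ      ≤⟨ +-monoʳ-≤ (4 * (k * q)) (m≤m+n μ (μ + 0)) ⟩
        4 * (k * q) + 2 * μ  ≡⟨ 2wk≡4kq+2μ ⟨
        2 * w * k            ≤⟨ *-monoʳ-≤ (2 * w) (<⇒≤ (≰⇒> 2h≰k)) ⟩
        2 * w * (2 * h)      ≡⟨ regroup w h ⟩
        4 * (w * h)          ∎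
      ... | yes 2h≤k = +-cancelʳ-≤ μ _ _ (begin
        4 * (k * q) + μ + μ        ≡⟨ double (4 * (k * q)) μ ⟩
        4 * (k * q) + 2 * μ        ≡⟨ 2wk≡4kq+2μ ⟨
        2 * w * k                  ≡⟨ cong (2 * w *_) (m+[n∸m]≡n 2h≤k) ⟨
        2 * w * (2 * h + X)        ≡⟨ *-distribˡ-+ (2 * w) (2 * h) X ⟩
        2 * w * (2 * h) + 2 * w * X ≡⟨ cong (_+ 2 * w * X) (regroup w h) ⟩
        4 * (w * h) + 2 * w * X    ≤⟨ +-monoʳ-≤ (4 * (w * h)) 2wX≤μ ⟩
        4 * (w * h) + μ            ∎)
        where
        double : ∀ s t → s + t + t ≡ s + 2 * t
        double = solve-∀
        X²<8kL : X * X < 8 * k * L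
        X²<8kL = ≰⇒> (λ bound → far (near-intro a c 2h≤k bound))
        square : ∀ w X → 2 * w * X * (2 * w * X) ≡ 4 * (w * w) * (X * X)
        square = solve-∀
        expand : ∀ w k L → 4 * (w * w) * (8 * k * L) + 32 * (w * w * k * L) ≡ 64 * (w * w * k * L)
        expand = solve-∀
        2wX≤μ : 2 * w * X ≤ μ
        2wX≤μ = ≮⇒≥ λ μ<2wX → <⇒≱ (*-mono-< μ<2wX μ<2wX) (begin
          2 * w * X * (2 * w * X)    ≡⟨ square w X ⟩
          4 * (w * w) * (X * X)      ≤⟨ *-monoʳ-≤ (4 * (w * w)) (<⇒≤ X²<8kL) ⟩
          4 * (w * w) * (8 * k * L)  ≤⟨ m≤m+n _ (32 * (w * w * k * L)) ⟩
          4 * (w * w) * (8 * k * L) + 32 * (w * w * k * L) ≡⟨ expand w k L ⟩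
          64 * (w * w * k * L)       ≤⟨ 64w²kL≤μ² ⟩
          μ * μ                      ∎)

    -- From 4pq = u² ≤ w², the variance kpq of w h is at most w²k/4, one sixteenth of the threshold.
    tail-mass : ∀ (a : Address k) → 16 * ∑ (addresses k) (λ c → 𝟙 (¬? (near? a c)) * mass a c) ≤ w ^ k
    tail-mass a = *-cancelˡ-≤ (w * w * k) {{m*n≢0 (w * w) k}} (begin
      w * w * k * (16 * T)            ≡⟨ regroup (w * w * k) T ⟩
      4 * (4 * (w * w * k) * T)       ≤⟨ *-monoʳ-≤ 4 (chebyshev a (λ c → ¬? (near? a c)) (4 * (w * w * k)) (far-deviates a)) ⟩
      4 * (k * p * q * W)             ≡⟨ identity k m W ⟩
      u * u * k * W                   ≤⟨ *-monoˡ-≤ W (*-monoˡ-≤ k (*-mono-≤ (n≤1+n u) (n≤1+n u))) ⟩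
      w * w * k * W                   ∎)
      where
      T = ∑ (addresses k) (λ c → 𝟙 (¬? (near? a c)) * mass a c)
      W = w ^ k
      regroup : ∀ s T → s * (16 * T) ≡ 4 * (4 * s * T)
      regroup = solve-∀
      identity : ∀ k m W → 4 * (k * (suc m * suc m) * (m * m) * W) ≡ 2 * (m * suc m) * (2 * (m * suc m)) * k * W
      identity = solve-∀

-- Uniform distributions

-- The number n/(`d-1` + 1), made from an unnormalised rational so that identities reduce to cross
-- multiplication of integers.
fraction : ℕ → ℕ → ℚ
fraction n d-1 = ℚ.fromℚᵘ (mkℚᵘ (ℤ.+ n) d-1)

fraction-suc : ∀ n d-1 → fraction 1 d-1 ℚ.+ fraction n d-1 ≡ fraction (suc n) d-1
fraction-suc n d-1 = ℚ.toℚᵘ-injective (begin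
  ℚ.toℚᵘ (fraction 1 d-1 ℚ.+ fraction n d-1)
    ≈⟨ ℚ.toℚᵘ-homo-+ (fraction 1 d-1) (fraction n d-1) ⟩
  ℚ.toℚᵘ (fraction 1 d-1) ℚᵘ.+ ℚ.toℚᵘ (fraction n d-1)
    ≈⟨ ℚᵘ.+-cong (ℚ.toℚᵘ-fromℚᵘ (mkℚᵘ (ℤ.+ 1) d-1)) (ℚ.toℚᵘ-fromℚᵘ (mkℚᵘ (ℤ.+ n) d-1)) ⟩
  mkℚᵘ (ℤ.+ 1) d-1 ℚᵘ.+ mkℚᵘ (ℤ.+ n) d-1
    ≈⟨ *≡* (trans (cong (ℤ._* ℤ.+ suc d-1) (sym (ℤ.*-distribʳ-+ (ℤ.+ suc d-1) (ℤ.+ 1) (ℤ.+ n))))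
                  (ℤ.*-assoc (ℤ.+ suc n) (ℤ.+ suc d-1) (ℤ.+ suc d-1))) ⟩
  mkℚᵘ (ℤ.+ suc n) d-1
    ≈⟨ ℚ.toℚᵘ-fromℚᵘ (mkℚᵘ (ℤ.+ suc n) d-1) ⟨
  ℚ.toℚᵘ (fraction (suc n) d-1) ∎)
  where open import Relation.Binary.Reasoning.Setoid ℚᵘ.≃-setoid

sumℚ-equalWeights : ∀ d-1 (xs : List A) → sumℚ (map proj₁ (map (fraction 1 d-1 ,_) xs)) ≡ fraction (length xs) d-1
sumℚ-equalWeights d-1 []       = ℚ.fromℚᵘ-cong {mkℚᵘ (ℤ.+ 0) 0} {mkℚᵘ (ℤ.+ 0) d-1} (*≡* refl)
sumℚ-equalWeights d-1 (x ∷ xs) = trans (cong (fraction 1 d-1 ℚ.+_) (sumℚ-equalWeights d-1 xs))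
                                       (fraction-suc (length xs) d-1)

0≤fraction : ∀ n d-1 → 0ℚ ℚ.≤ fraction n d-1
0≤fraction n d-1 = ℚ.toℚᵘ-cancel-≤ (ℚᵘ.≤-respʳ-≃ (ℚᵘ.≃-sym (ℚ.toℚᵘ-fromℚᵘ (mkℚᵘ (ℤ.+ n) d-1)))
  (*≤* (ℤ.≤-trans (ℤ.+≤+ z≤n) (ℤ.≤-reflexive (sym (ℤ.*-identityʳ (ℤ.+ n)))))))

module Uniform (xs : List A) {d-1 : ℕ} (length≡ : length xs ≡ suc d-1) where

  uniform : Distribution A
  uniform = record
    { weighted = map (fraction 1 d-1 ,_) xs
    ; nonNeg   = allNonNeg xs
    ; total    = trans (sumℚ-equalWeights d-1 xs) (trans (cong (λ n → fraction n d-1) length≡)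
                   (ℚ.fromℚᵘ-cong {mkℚᵘ (ℤ.+ suc d-1) d-1} {mkℚᵘ (ℤ.+ 1) 0} (*≡* (ℤ.*-comm (ℤ.+ suc d-1) (ℤ.+ 1)))))
    }
    where
    allNonNeg : ∀ ys → All (λ wa → 0ℚ ℚ.≤ proj₁ wa) (map (fraction 1 d-1 ,_) ys)
    allNonNeg []       = All.[]
    allNonNeg (y ∷ ys) = 0≤fraction 1 d-1 All.∷ allNonNeg ys

  module _ {P : A → Set} (P? : Decidable P) where

    prob-uniform : prob uniform P? ≡ fraction (# P? xs) d-1
    prob-uniform = begin
      sumℚ (map proj₁ (filter (P? ∘ proj₂) (map (ω ,_) xs))) ≡⟨ cong (sumℚ ∘ map proj₁) (filter-weighted xs) ⟩
      sumℚ (map proj₁ (map (ω ,_) (filter P? xs)))           ≡⟨ sumℚ-equalWeights d-1 (filter P? xs) ⟩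
      fraction (length (filter P? xs)) d-1                   ≡⟨ cong (λ n → fraction n d-1) (length-filter≡# P? xs) ⟩
      fraction (# P? xs) d-1                                 ∎
      where
      open ≡-Reasoning
      ω = fraction 1 d-1
      filter-weighted : ∀ ys → filter (P? ∘ proj₂) (map (ω ,_) ys) ≡ map (ω ,_) (filter P? ys)
      filter-weighted [] = refl
      filter-weighted (y ∷ ys) with P? y
      ... | yes _ = cong ((ω , y) ∷_) (filter-weighted ys)
      ... | no  _ = filter-weighted ys

    1≤c*prob : ∀ c → length xs ≤ c * # P? xs → 1ℚ ℚ.≤ (ℤ.+ c ℚ./ 1) ℚ.* prob uniform P?
    1≤c*prob c bound rewrite prob-uniform = ℚ.toℚᵘ-cancel-≤ (begin
      mkℚᵘ (ℤ.+ 1) 0                                          ≤⟨ *≤* inℤ ⟩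
      mkℚᵘ (ℤ.+ c) 0 ℚᵘ.* mkℚᵘ (ℤ.+ n) d-1                      ≃⟨ ℚᵘ.*-cong (ℚ.toℚᵘ-fromℚᵘ (mkℚᵘ (ℤ.+ c) 0)) (ℚ.toℚᵘ-fromℚᵘ (mkℚᵘ (ℤ.+ n) d-1)) ⟨
      ℚ.toℚᵘ (ℤ.+ c ℚ./ 1) ℚᵘ.* ℚ.toℚᵘ (fraction n d-1)       ≃⟨ ℚ.toℚᵘ-homo-* (ℤ.+ c ℚ./ 1) (fraction n d-1) ⟨
      ℚ.toℚᵘ ((ℤ.+ c ℚ./ 1) ℚ.* fraction n d-1)               ∎)
      where
      open ℚᵘ.≤-Reasoning
      n = # P? xs
      inℤ : ℤ.+ 1 ℤ.* ℚᵘ.↧ (mkℚᵘ (ℤ.+ c) 0 ℚᵘ.* mkℚᵘ (ℤ.+ n) d-1) ℤ.≤ (ℤ.+ c ℤ.* ℤ.+ n) ℤ.* ℤ.+ 1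
      inℤ = ℤ.≤-trans (ℤ.+≤+ (≤-trans (≤-reflexive (trans (*-identityˡ _) (trans (+-identityʳ _) (sym length≡)))) bound))
              (ℤ.≤-reflexive (trans (ℤ.pos-* c n) (sym (ℤ.*-identityʳ (ℤ.+ c ℤ.* ℤ.+ n)))))

    reciprocal-prob≤ : ∀ c → length xs ≤ c * # P? xs → reciprocal (prob uniform P?) ≤⁺ [ ℤ.+ c ℚ./ 1 ]
    reciprocal-prob≤ c bound = inverse (prob uniform P?) 0≤prob (1≤c*prob c bound)
      where
      0≤prob : 0ℚ ℚ.≤ prob uniform P?
      0≤prob = ℚ.≤-trans (0≤fraction (# P? xs) d-1) (ℚ.≤-reflexive (sym prob-uniform))
      -- With a variable r, the case distinction on r = 0 computes `reciprocal r`; the value +∞ is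
      -- excluded by 1 ≤ c r.
      inverse : ∀ r → 0ℚ ℚ.≤ r → 1ℚ ℚ.≤ (ℤ.+ c ℚ./ 1) ℚ.* r → reciprocal r ≤⁺ [ ℤ.+ c ℚ./ 1 ]
      inverse r 0≤r 1≤cr with r ℚ.≟ 0ℚ
      ... | yes refl = contradiction (ℚ.≤-trans 1≤cr (ℚ.≤-reflexive (ℚ.*-zeroʳ (ℤ.+ c ℚ./ 1)))) λ where (ℚ.*≤* (ℤ.+≤+ ()))
      ... | no r≢0 = [ ℚ.*-cancelʳ-≤-pos r {{positive}}
                         (ℚ.≤-trans (ℚ.≤-reflexive (ℚ.*-inverseˡ r {{ℚ.≢-nonZero r≢0}})) 1≤cr) ]
        where
        positive : ℚ.Positive r
        positive = ℚ.nonNeg∧nonZero⇒pos r {{ℚ.nonNegative 0≤r}} {{ℚ.≢-nonZero r≢0}}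

-- The choice of the bias

k<2^suc⌊log₂k⌋ : ∀ k → k < 2 ^ suc ⌊log₂ k ⌋
k<2^suc⌊log₂k⌋ k = ≰⇒> λ 2^sucL≤k → 1+n≰n (≤-trans
  (≤-reflexive (sym (⌊log₂[2^n]⌋≡n (suc ⌊log₂ k ⌋)))) (⌊log₂⌋-mono-≤ 2^sucL≤k))

linear≤2^ : ∀ c n → c * suc n ≤ 2 ^ n → ∀ i → c * suc (i + n) ≤ 2 ^ (i + n)
linear≤2^ c n base zero = base
linear≤2^ c n base (suc i) = begin
  c * suc (suc (i + n))   ≤⟨ ≤-byWitness (c * (i + n)) (identity c (i + n)) ⟩
  2 * (c * suc (i + n))   ≤⟨ *-monoʳ-≤ 2 (linear≤2^ c n base i) ⟩
  2 ^ suc (i + n)         ∎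
  where
  open ≤-Reasoning
  identity : ∀ c t → c * suc (suc t) + c * t ≡ 2 * (c * suc t)
  identity = solve-∀

-- With j = ⌊k/64⌋ it suffices that k < 64(j+1) ≤ 2^j. The last inequality first holds at j = 10, as
-- 704 ≤ 1024, hence 640 = 64 · 10.
64⌊log₂k⌋≤k : ∀ {k} → 640 ≤ k → 64 * ⌊log₂ k ⌋ ≤ k
64⌊log₂k⌋≤k {k} 640≤k = begin
  64 * ⌊log₂ k ⌋  ≤⟨ *-monoʳ-≤ 64 log≤j ⟩
  64 * j          ≡⟨ *-comm 64 j ⟩
  j * 64          ≤⟨ m/n*n≤m k 64 ⟩
  k               ∎
  where
  open ≤-Reasoning
  j = k / 64
  k<64[1+j] : k < 64 * suc j
  k<64[1+j] = begin-strict
    k                  ≡⟨ m≡m%n+[m/n]*n k 64 ⟩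
    k % 64 + j * 64    <⟨ +-monoˡ-< (j * 64) (m%n<n k 64) ⟩
    64 + j * 64        ≡⟨ *-comm (suc j) 64 ⟩
    64 * suc j         ∎
  10≤j : 10 ≤ j
  10≤j = s≤s⁻¹ (*-cancelˡ-< 64 10 (suc j) (≤-<-trans 640≤k k<64[1+j]))
  log≤j : ⌊log₂ k ⌋ ≤ j
  log≤j = ≤-trans (⌊log₂⌋-mono-≤ k≤2^j) (≤-reflexive (⌊log₂[2^n]⌋≡n j))
    where
    k≤2^j : k ≤ 2 ^ j
    k≤2^j = ≤-trans (<⇒≤ k<64[1+j]) (subst (λ j → 64 * suc j ≤ 2 ^ j) (m∸n+n≡m 10≤j) (linear≤2^ 64 10 (≤ᵇ⇒≤ 704 1024 _) (j ∸ 10)))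

-- A downward search from n ends at the latest at `f 0`; the value rejected just before supplies the
-- strict inequality.
lastBelow : ∀ (f : ℕ → ℕ) {k} n → f 0 ≤ k → k < f n → ∃[ m ] (f m ≤ k × k < f (suc m))
lastBelow f zero    f0≤k k<fn = contradiction f0≤k (<⇒≱ k<fn)
lastBelow f {k} (suc n) f0≤k k<fn with f n ≤? k
... | yes fn≤k = n , fn≤k , k<fn
... | no  fn≰k = lastBelow f n f0≤k (≰⇒> fn≰k)

open ProductWeights using (w)

-- The first inequality makes the bias strong enough for the ball. The second makes the measures as
-- flat as the first allows, which ties w to k/L.
∃bias : ∀ k L {{_ : NonZero L}} → 64 * L ≤ k → ∃[ m ] (64 * w m * L ≤ k × k < 64 * w (suc m) * L)
∃bias k L 64L≤k = lastBelow (λ m → 64 * w m * L) k 64L≤k (begin-strict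
  k               ≤⟨ m≤m*n k (suc k) ⟩
  k * suc k       ≤⟨ m≤n*m (k * suc k) 2 ⟩
  2 * (k * suc k) <⟨ n<1+n _ ⟩
  w k             ≤⟨ m≤n*m (w k) 64 ⟩
  64 * w k        ≤⟨ m≤m*n (64 * w k) L ⟩
  64 * w k * L    ∎)
  where open ≤-Reasoning

-- Rounding to the grid of available biases costs a constant factor; m = 0 is the extreme case, with
-- w going from 1 to 5.
w-suc≤ : ∀ m → w (suc m) ≤ 5 * w m
w-suc≤ m = ≤-byWitness (8 * (m * m) + 4 * m) (identity m)
  where
  identity : ∀ m → suc (2 * (suc m * suc (suc m))) + (8 * (m * m) + 4 * m) ≡ 5 * suc (2 * (m * suc m))
  identity = solve-∀

-- The approximate index function

lookupDiffers? : ∀ {k} (a b : Address k) → Decidable (λ i → lookup a i ≢ lookup b i)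
lookupDiffers? a b i = ¬? (lookup a i Bool.≟ lookup b i)

#-lookupDiffers : ∀ {k} (a b : Address k) → # (lookupDiffers? a b) (allFin k) ≡ hamming a b
#-lookupDiffers []      []      = refl
#-lookupDiffers {suc k} (x ∷ a) (y ∷ b) = trans (cong (𝟙 (¬? (x Bool.≟ y)) +_) shift) (cases x y)
  where
  shift : ∑ (tabulate suc) (λ i → 𝟙 (lookupDiffers? (x ∷ a) (y ∷ b) i)) ≡ hamming a b
  shift = begin
    ∑ (tabulate suc) (λ i → 𝟙 (lookupDiffers? (x ∷ a) (y ∷ b) i))
      ≡⟨ cong (λ is → ∑ is (λ i → 𝟙 (lookupDiffers? (x ∷ a) (y ∷ b) i))) (map-tabulate id suc) ⟨
    ∑ (map suc (allFin k)) (λ i → 𝟙 (lookupDiffers? (x ∷ a) (y ∷ b) i))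
      ≡⟨ ∑-map suc (allFin k) _ ⟩
    # (lookupDiffers? a b) (allFin k)
      ≡⟨ #-lookupDiffers a b ⟩
    hamming a b ∎
    where open ≡-Reasoning
  cases : ∀ x y → 𝟙 (¬? (x Bool.≟ y)) + hamming a b ≡ hamming (x ∷ a) (y ∷ b)
  cases true  true  = refl
  cases true  false = refl
  cases false true  = refl
  cases false false = refl

length-addresses : ∀ k → length (addresses k) ≡ 2 ^ k
length-addresses zero    = refl
length-addresses (suc k) = begin
  length (addresses (suc k))                          ≡⟨ length≡∑1 (addresses (suc k)) ⟩
  ∑ (addresses (suc k)) (λ _ → 1)                     ≡⟨ ∑-addresses k (λ _ → 1) ⟩
  ∑ (addresses k) (λ _ → 1) + ∑ (addresses k) (λ _ → 1) ≡⟨ cong (λ n → n + n) (trans (sym (length≡∑1 (addresses k))) (length-addresses k)) ⟩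
  2 ^ k + 2 ^ k                                       ≡⟨ cong (2 ^ k +_) (+-identityʳ (2 ^ k)) ⟨
  2 ^ suc k                                           ∎
  where open ≡-Reasoning

apInd≡just⇒Encodes : ∀ {k} v (x : ApInput k) → apInd x ≡ just v → Encodes v x
apInd≡just⇒Encodes v x = decode {λ v → Encodes v x} (encodes? false x) (encodes? true x) v
  where
  -- With the two decisions as variables, matching on them evaluates the nested conditional.
  decode : ∀ {E : Bool → Set} (d₀ : Dec (E false)) (d₁ : Dec (E true)) v →
    (if does d₀ then just false else if does d₁ then just true else nothing) ≡ just v → E v
  decode (yes e) d₁      false refl = e
  decode (no _)  (yes e) true  refl = e

-- The strategies and their success probability

module Strategies (k m : ℕ) where
  open ProductWeights m hiding (w)
  open CertificateGame (ApInd k)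

  -- The largest mass, attained at c = a.
  bound : ℕ
  bound = suc m ^ k * suc m ^ k

  -- `id` answers in the runs where nothing is accepted; the lower bound on successes credits it
  -- with none.
  open CorrelatedSampling mass (addresses k) bound id public

  samplers : List (Address k → Address k)
  samplers = rounds enoughRounds

  -- In either half every map occurs with the same multiplicity: the first
  -- half outputs a random address bit, the second a correlated sample.
  positionMaps : List (Address k → ApPosition k)
  positionMaps = cartesianProductWith (λ i _ _ → inj₁ i) (allFin k) samplers ++
                 cartesianProductWith (λ _ g → inj₂ ∘ g) (allFin k) samplers

  -- Both players apply one map to their own addresses and never read their tables, whose entries
  -- the promise determines.
  onAddresses : (Address k → ApPosition k) → StrategyPair
  onAddresses g = (λ u → g (proj₁ (proj₁ u))) , (λ v → g (proj₁ (proj₁ v)))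

  strategies : List StrategyPair
  strategies = map onAddresses positionMaps

  length-strategies : length strategies ≡ 2 * k * length samplers
  length-strategies = begin
    length strategies        ≡⟨ length-map onAddresses positionMaps ⟩
    length positionMaps      ≡⟨ length-++ (cartesianProductWith (λ i _ _ → inj₁ i) (allFin k) samplers) ⟩
    _                        ≡⟨ cong₂ _+_ (half (λ i _ _ → inj₁ i)) (half (λ _ g → inj₂ ∘ g)) ⟩
    k * R + k * R            ≡⟨ double k R ⟩
    2 * k * R                ∎
    where
    open ≡-Reasoning
    R = length samplers
    half : ∀ {C : Set} (h : Fin k → (Address k → Address k) → C) →
      length (cartesianProductWith h (allFin k) samplers) ≡ k * R
    half h = trans (length-cartesianProductWith h (allFin k) samplers) (cong (_* R) (length-tabulate {n = k} id))
    double : ∀ k R → k * R + k * R ≡ 2 * k * R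
    double = solve-∀

  samplers-nonZero : NonZero (length samplers)
  samplers-nonZero = subst NonZero (sym (length-rounds enoughRounds))
    (m^n≢0 (length proposals) enoughRounds {{proposals-nonZero}})
    where
    instance
      levels-nonZero : NonZero bound
      levels-nonZero = m*n≢0 (suc m ^ k) (suc m ^ k) {{m^n≢0 (suc m) k}} {{m^n≢0 (suc m) k}}
      addresses-nonZero : NonZero (2 ^ k)
      addresses-nonZero = m^n≢0 2 k
    proposals-nonZero : NonZero (length proposals)
    proposals-nonZero = subst NonZero
      (sym (trans (length-cartesianProductWith _,_ (addresses k) (downFrom bound))
                  (cong₂ _*_ (length-addresses k) (length-downFrom bound))))
      (m*n≢0 (2 ^ k) bound)

  module _ (u : Preimage false) (v : Preimage true) where
    a b : Address k
    a = proj₁ (proj₁ u)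
    b = proj₁ (proj₁ v)

    correct-bit : ∀ i → lookup a i ≢ lookup b i → Correct u v (onAddresses (λ _ → inj₁ i))
    correct-bit i differ = refl , differ

    -- At c near a the table of u has bit false, that of v bit true or two.
    correct-entry : ∀ (g : Address k → Address k) → g a ≡ g b × Near a (g a) → Correct u v (onAddresses (inj₂ ∘ g))
    correct-entry g (agree , near) = cong inj₂ agree , λ same → differ (near? b (g a)) same
      where
      encodesᵘ = apInd≡just⇒Encodes false (proj₁ u) (proj₂ u)
      encodesᵛ = apInd≡just⇒Encodes true  (proj₁ v) (proj₂ v)
      xᵘ≡0 = proj₁ (proj₂ encodesᵘ (g a)) near
      differ : Dec (Near b (g a)) → proj₂ (proj₁ u) (g a) ≢ proj₂ (proj₁ v) (g a)
      differ (yes near′) same with () ← trans (sym xᵘ≡0) (trans same (proj₁ (proj₂ encodesᵛ (g a)) near′))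
      differ (no  far)   same with () ← trans (sym xᵘ≡0) (trans same (proj₂ (proj₂ encodesᵛ (g a)) far))

    successes : ℕ
    successes = # (success? (near? a) _≟ᵃ_ a b) samplers

    -- Each half of the list consists of k blocks as long as `samplers`. A differing bit makes its
    -- whole block correct, and every block of table positions has at least `successes` correct
    -- entries.
    #correct-lower : hamming a b * length samplers + k * successes ≤ # (correct? u v) strategies
    #correct-lower = begin
      hamming a b * length samplers + k * successes
        ≡⟨ cong₂ _+_ (cong (_* length samplers) (#-lookupDiffers a b)) (cong (_* successes) (length-tabulate {n = k} id)) ⟨
      # (lookupDiffers? a b) (allFin k) * length samplers + length (allFin k) * successes
        ≡⟨ cong₂ _+_ (∑-*ʳ (allFin k) _ (length samplers)) (∑-const (allFin k) successes) ⟨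
      ∑ (allFin k) (λ i → 𝟙 (lookupDiffers? a b i) * length samplers) + ∑ (allFin k) (λ _ → successes)
        ≤⟨ +-mono-≤ (∑-mono (allFin k) bits) (∑-mono (allFin k) (λ _ → entries)) ⟩
      ∑ (allFin k) (λ i → ∑ samplers (λ _ → score (λ _ → inj₁ i))) + ∑ (allFin k) (λ _ → ∑ samplers (λ g → score (inj₂ ∘ g)))
        ≡⟨ cong₂ _+_ (∑-cartesianProductWith (λ i _ _ → inj₁ i) (allFin k) samplers score)
                     (∑-cartesianProductWith (λ _ g → inj₂ ∘ g) (allFin k) samplers score) ⟨
      ∑ (cartesianProductWith (λ i _ _ → inj₁ i) (allFin k) samplers) score +
      ∑ (cartesianProductWith (λ _ g → inj₂ ∘ g) (allFin k) samplers) score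
        ≡⟨ ∑-++ (cartesianProductWith (λ i _ _ → inj₁ i) (allFin k) samplers) _ score ⟨
      ∑ positionMaps score
        ≡⟨ ∑-map onAddresses positionMaps _ ⟨
      # (correct? u v) strategies ∎
      where
      open ≤-Reasoning
      score : (Address k → ApPosition k) → ℕ
      score g = 𝟙 (correct? u v (onAddresses g))
      bits : ∀ i → 𝟙 (lookupDiffers? a b i) * length samplers ≤ ∑ samplers (λ _ → score (λ _ → inj₁ i))
      bits i = begin
        𝟙 (lookupDiffers? a b i) * length samplers
          ≤⟨ *-monoˡ-≤ (length samplers) (𝟙-mono (lookupDiffers? a b i) (correct? u v (onAddresses (λ _ → inj₁ i))) (correct-bit i)) ⟩
        score (λ _ → inj₁ i) * length samplers
          ≡⟨ *-comm _ (length samplers) ⟩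
        length samplers * score (λ _ → inj₁ i)
          ≡⟨ ∑-const samplers _ ⟨
        ∑ samplers (λ _ → score (λ _ → inj₁ i)) ∎
      entries : successes ≤ ∑ samplers (λ g → score (inj₂ ∘ g))
      entries = #-mono (success? (near? a) _≟ᵃ_ a b) (λ g → correct? u v (onAddresses (inj₂ ∘ g))) samplers correct-entry

  module _ {L} {{_ : NonZero k}} {{_ : NonZero L}} (k<2^ : k < 2 ^ suc L)
           (lower : 64 * w m * L ≤ k) (upper : k < 64 * w (suc m) * L) where
    open ≤-Reasoning

    -- 24 = 8 · 3: the overlap within the ball is at least W/8, and `suc total` = 1 + 2W ≤ 3W.
    #samplers≤24*successes : ∀ u v → 4 * hamming (a u v) (b u v) ≤ w m → length samplers ≤ 24 * successes u v
    #samplers≤24*successes u v close = *-cancelˡ-≤ W {{m^n≢0 (w m) k}} (begin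
      W * R                   ≤⟨ *-monoˡ-≤ R (shared-lower α β (near? α) close (tail-mass k<2^ lower α)) ⟩
      8 * G * R               ≡⟨ *-assoc 8 G R ⟩
      8 * (G * R)             ≤⟨ *-monoʳ-≤ 8 (#success-enoughRounds (near? α) _≟ᵃ_ α β mass≤bound) ⟩
      8 * (N * suc (total (near? α) _≟ᵃ_ α β)) ≡⟨ cong (λ t → 8 * (N * suc t)) (∑-mass₂ α β) ⟩
      8 * (N * (1 + (W + W))) ≤⟨ *-monoʳ-≤ 8 (*-monoʳ-≤ N (+-monoˡ-≤ (W + W) (>-nonZero⁻¹ W {{m^n≢0 (w m) k}}))) ⟩
      8 * (N * (W + (W + W))) ≡⟨ regroup N W ⟩
      W * (24 * N)            ∎)
      where
      α = a u v
      β = b u v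
      W = w m ^ k
      R = length samplers
      N = successes u v
      G = shared (near? α) _≟ᵃ_ α β
      mass≤bound : ∀ c → mass α c ≤ bound
      mass≤bound c = *-mono-≤ (amplitude≤ α c) (amplitude≤ α c)
      regroup : ∀ N W → 8 * (N * (W + (W + W))) ≡ W * (24 * N)
      regroup = solve-∀

    -- 1280 = 64 · 5 · 4, from the choice of m, the growth of w in one step and the threshold w <
    -- 4d.
    k≤1280*hamming*L : ∀ d → w m < 4 * d → k ≤ 1280 * d * L
    k≤1280*hamming*L d w<4d = begin
      k                       ≤⟨ <⇒≤ upper ⟩
      64 * w (suc m) * L      ≤⟨ *-monoˡ-≤ L (*-monoʳ-≤ 64 (≤-trans (w-suc≤ m) (*-monoʳ-≤ 5 (<⇒≤ w<4d)))) ⟩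
      64 * (5 * (4 * d)) * L  ≡⟨ cong (_* L) (trans (cong (64 *_) (sym (*-assoc 5 4 d))) (sym (*-assoc 64 20 d))) ⟩
      1280 * d * L            ∎

    -- Each case credits one half of the list only, at the price of a factor 2: 2 · 24 = 48 for
    -- close addresses, 2 · 1280 L for distant ones. The logarithm is lost only in the latter case.
    length-strategies≤ : ∀ u v → length strategies ≤ 2560 * L * # (correct? u v) strategies
    length-strategies≤ u v = begin
      length strategies             ≡⟨ length-strategies ⟩
      2 * k * R                     ≤⟨ cases (4 * d ≤? w m) ⟩
      2560 * L * (d * R + k * N)    ≤⟨ *-monoʳ-≤ (2560 * L) (#correct-lower u v) ⟩
      2560 * L * # (correct? u v) strategies ∎
      where
      d = hamming (a u v) (b u v)
      R = length samplers
      N = successes u v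
      cases : Dec (4 * d ≤ w m) → 2 * k * R ≤ 2560 * L * (d * R + k * N)
      cases (yes close) = begin
        2 * k * R                   ≤⟨ *-monoʳ-≤ (2 * k) (#samplers≤24*successes u v close) ⟩
        2 * k * (24 * N)            ≡⟨ regroup k N ⟩
        48 * (k * N)                ≤⟨ *-mono-≤ (≤-trans (≤ᵇ⇒≤ 48 2560 _) (m≤m*n 2560 L)) (m≤n+m (k * N) (d * R)) ⟩
        2560 * L * (d * R + k * N)  ∎
        where
        regroup : ∀ k N → 2 * k * (24 * N) ≡ 48 * (k * N)
        regroup = solve-∀
      cases (no apart) = begin
        2 * k * R                   ≤⟨ *-monoˡ-≤ R (*-monoʳ-≤ 2 (k≤1280*hamming*L d (≰⇒> apart))) ⟩
        2 * (1280 * d * L) * R      ≡⟨ regroup 1280 d L R ⟩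
        2560 * L * (d * R)          ≤⟨ *-monoʳ-≤ (2560 * L) (m≤m+n (d * R) (k * N)) ⟩
        2560 * L * (d * R + k * N)  ∎
        where
        regroup : ∀ x d L R → 2 * (x * d * L) * R ≡ 2 * x * L * (d * R)
        regroup = solve-∀

    CGpub-ApInd≤ : CGpub ApInd k ≤ (ℤ.+ (2560 * L) ℚ./ 1)
    CGpub-ApInd≤ = uniform , λ u v → reciprocal-prob≤ (correct? u v) (2560 * L) (length-strategies≤ u v)
      where
      nonEmpty : NonZero (length strategies)
      nonEmpty = subst NonZero (sym length-strategies) (m*n≢0 (2 * k) (length samplers) {{m*n≢0 2 k}} {{samplers-nonZero}})
      open Uniform strategies (sym (suc-pred (length strategies) {{nonEmpty}}))

theoremA2 : CGpub ApInd ≤O (λ k → ⌊log₂ k ⌋)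
theoremA2 = 2560 , 640 , bounded
  where
  bounded : ∀ k → k ≥ 640 → CGpub ApInd k ≤ (ℤ.+ (2560 * ⌊log₂ k ⌋) ℚ./ 1)
  bounded k 640≤k = Strategies.CGpub-ApInd≤ k (proj₁ bias) (k<2^suc⌊log₂k⌋ k) (proj₁ (proj₂ bias)) (proj₂ (proj₂ bias))
    where
    instance
      k≢0 : NonZero k
      k≢0 = >-nonZero (≤-trans (s≤s z≤n) 640≤k)
      L≢0 : NonZero ⌊log₂ k ⌋
      L≢0 = >-nonZero (⌊log₂⌋-mono-≤ {2} (≤-trans (s≤s (s≤s z≤n)) 640≤k))
    bias = ∃bias k ⌊log₂ k ⌋ (64⌊log₂k⌋≤k 640≤k)
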